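{- Let $G$ be a cactus. Then $G$ is in $B_0$ if and only if $G$ contains none of $M_2$, $M_3$, and $C_r$ for any $r\ge 4$ as an induced subgraph.
   Context: A cactus is a connected graph in which any two simple cycles have at most one vertex in common. $C_r$ denotes the cycle on $r$ vertices. $M_2$ is the graph on vertices $a,b,c,d,e,f,g$ with edges $ab,ac,ad,be,cf,dg$. $M_3$ is the graph on vertices $a,b,c,d,e,f$ with edges $ab,ac,bc,ad,be,cf$. $B_0$ is the class of graphs having an EPG representation (a set of paths on a rectangular grid, one per vertex, two vertices adjacent iff their paths share a grid edge) in which no path has a bend. -}

module Defs where

open import Data.Fin using (Fin; toℕ; inject₁; #_) renaming (suc to fsuc)
open import Data.Fin.Properties using () renaming (_≟_ to _≟ᶠ_)
open import Data.List using (List; []; _∷_)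
import Data.List.Membership.DecPropositional as DecMembership
open import Data.Nat using (ℕ; suc; _≤_; _≟_)
open import Data.Product using (Σ-syntax; ∃-syntax; _×_; _,_; proj₁; proj₂)
open import Data.Product.Properties using (≡-dec)
open import Data.Sum using (_⊎_; swap)
open import Function using (_∘_)
open import Function.Bundles using (_⇔_)
open import Function.Definitions using (Injective)
open import Relation.Binary.Construct.Closure.ReflexiveTransitive using (Star)
open import Relation.Binary.Core using (Rel)
open import Relation.Binary.Definitions using (Decidable; Irreflexive; Symmetric)
open import Relation.Binary.PropositionalEquality using (_≡_; _≢_; sym)
open import Relation.Nullary using (¬_)
open import Relation.Nullary.Decidable using (¬?; _×-dec_; _⊎-dec_)
open import Level using (0ℓ)

-- Finite simple graphs on the vertex set Fin n.  Decidability of adjacency is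
-- automatic classically; here it is part of what "finite graph" means.
record Graph (n : ℕ) : Set₁ where
  field
    Adj    : Rel (Fin n) 0ℓ
    adj?   : Decidable Adj
    symm   : Symmetric Adj
    irrefl : Irreflexive _≡_ Adj

open Graph public

fromRel : ∀ {n} (R : Rel (Fin n) 0ℓ) → Decidable R → Graph n
fromRel R R? = record
  { Adj    = λ i j → i ≢ j × (R i j ⊎ R j i)
  ; adj?   = λ i j → ¬? (i ≟ᶠ j) ×-dec (R? i j ⊎-dec R? j i)
  ; symm   = λ { (i≢j , e) → i≢j ∘ sym , swap e }
  ; irrefl = λ { i≡j (i≢j , _) → i≢j i≡j }
  }

fromEdges : ∀ {n} → List (Fin n × Fin n) → Graph n
fromEdges es = fromRel (λ i j → (i , j) ∈ es) (λ i j → (i , j) ∈? es)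
  where open DecMembership (≡-dec _≟ᶠ_ _≟ᶠ_)

-- a , b , c , d , e , f , g  are  0 , 1 , 2 , 3 , 4 , 5 , 6.
M₂ : Graph 7
M₂ = fromEdges
  ( (# 0 , # 1) ∷ (# 0 , # 2) ∷ (# 0 , # 3)
  ∷ (# 1 , # 4) ∷ (# 2 , # 5) ∷ (# 3 , # 6) ∷ [])

-- a , b , c , d , e , f  are  0 , 1 , 2 , 3 , 4 , 5.
M₃ : Graph 6
M₃ = fromEdges
  ( (# 0 , # 1) ∷ (# 0 , # 2) ∷ (# 1 , # 2)
  ∷ (# 0 , # 3) ∷ (# 1 , # 4) ∷ (# 2 , # 5) ∷ [])

-- j is the cyclic successor of i in 0 , 1 , … , r - 1.
Next : ∀ {r} → Rel (Fin r) 0ℓ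
Next {r} i j = suc (toℕ i) ≡ toℕ j ⊎ (suc (toℕ i) ≡ r × toℕ j ≡ 0)

next? : ∀ {r} → Decidable (Next {r})
next? {r} i j = (suc (toℕ i) ≟ toℕ j) ⊎-dec ((suc (toℕ i) ≟ r) ×-dec (toℕ j ≟ 0))

C : (r : ℕ) → Graph r
C r = fromRel Next next?

_IsInducedSubgraphOf_ : ∀ {m n} → Graph m → Graph n → Set
_IsInducedSubgraphOf_ {m} {n} H G =
  Σ[ f ∈ (Fin m → Fin n) ]
    Injective _≡_ _≡_ f × (∀ i j → Adj H i j ⇔ Adj G (f i) (f j))

Connected : ∀ {n} → Graph n → Set
Connected {n} G = Fin n × (∀ u v → Star (Adj G) u v)

record SimpleCycle {n} (G : Graph n) : Set where
  field
    size     : ℕ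
    3≤size   : 3 ≤ size
    vertex   : Fin size → Fin n
    distinct : Injective _≡_ _≡_ vertex
    step     : ∀ i j → Next i j → Adj G (vertex i) (vertex j)

module _ {n} {G : Graph n} where
  open SimpleCycle

  _∈ᵛ_ : Fin n → SimpleCycle G → Set
  x ∈ᵛ c = ∃[ i ] vertex c i ≡ x

  HasEdge : SimpleCycle G → Rel (Fin n) 0ℓ
  HasEdge c x y = ∃[ i ] ∃[ j ] Next i j ×
    ((vertex c i ≡ x × vertex c j ≡ y) ⊎ (vertex c i ≡ y × vertex c j ≡ x))

  -- Cycles are subgraphs: the starting point and the direction of traversal
  -- are irrelevant, so they are compared by their edge sets.
  SameCycle : Rel (SimpleCycle G) 0ℓ
  SameCycle c d = ∀ x y → HasEdge c x y ⇔ HasEdge d x y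

Cactus : ∀ {n} → Graph n → Set
Cactus G = Connected G ×
  (∀ (c d : SimpleCycle G) → ¬ SameCycle c d →
   ∀ x y → x ∈ᵛ c → x ∈ᵛ d → y ∈ᵛ c → y ∈ᵛ d → x ≡ y)

-- Points of the rectangular grid, as (row , column).
Point : ℕ → ℕ → Set
Point rows cols = Fin rows × Fin cols

Consecutive : ∀ {k} → Rel (Fin k) 0ℓ
Consecutive i j = suc (toℕ i) ≡ toℕ j ⊎ suc (toℕ j) ≡ toℕ i

module _ {rows cols : ℕ} where

  Horizontal Vertical GridAdj : Rel (Point rows cols) 0ℓ
  Horizontal p q = proj₁ p ≡ proj₁ q × Consecutive (proj₂ p) (proj₂ q)
  Vertical   p q = Consecutive (proj₁ p) (proj₁ q) × proj₂ p ≡ proj₂ q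
  GridAdj    p q = Horizontal p q ⊎ Vertical p q

-- Nontrivial simple paths of the grid: len edges, suc len distinct points.
record GridPath (rows cols : ℕ) : Set where
  field
    len      : ℕ
    1≤len    : 1 ≤ len
    point    : Fin (suc len) → Point rows cols
    distinct : Injective _≡_ _≡_ point
    step     : ∀ (i : Fin len) → GridAdj (point (inject₁ i)) (point (fsuc i))

module _ {rows cols : ℕ} where
  open GridPath

  source target : (P : GridPath rows cols) → Fin (len P) → Point rows cols
  source P i = point P (inject₁ i)
  target P i = point P (fsuc i)

  ShareEdge : Rel (GridPath rows cols) 0ℓ
  ShareEdge P Q = ∃[ i ] ∃[ j ]
    ((source P i ≡ source Q j × target P i ≡ target Q j) ⊎
     (source P i ≡ target Q j × target P i ≡ source Q j))

  BendAt : (P : GridPath rows cols) → Rel (Fin (len P)) 0ℓ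
  BendAt P i j = suc (toℕ i) ≡ toℕ j ×
    ((Horizontal (source P i) (target P i) × Vertical (source P j) (target P j)) ⊎
     (Vertical (source P i) (target P i) × Horizontal (source P j) (target P j)))

  HasBend : GridPath rows cols → Set
  HasBend P = ∃[ i ] ∃[ j ] BendAt P i j

record EPGRepresentation {n} (G : Graph n) : Set where
  field
    rows cols : ℕ
    path      : Fin n → GridPath rows cols
    adj⇔share : ∀ u v → u ≢ v → Adj G u v ⇔ ShareEdge (path u) (path v)

B₀ : ∀ {n} → Graph n → Set
B₀ G = Σ[ R ∈ EPGRepresentation G ]
  (∀ v → ¬ HasBend (EPGRepresentation.path R v))

{-# OPTIONS --safe #-}

-- A path without bends is an interval on a line of the grid, so a connected
-- induced subgraph of a B₀ graph is an interval graph.  An interval graph has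
-- no asteroidal triple, which excludes M₂ and M₃, and the neighbours of the
-- interval with the leftmost right end are pairwise adjacent, which excludes
-- the cycles C r with r ≥ 4.
--
-- Conversely, a cactus contains no two triangles with a common edge.  Without
-- induced C r, r ≥ 4, a vertex outside an induced path p₀ … p_k that has a
-- neighbour on it is therefore adjacent to one p_i or to two consecutive ones,
-- and outside vertices that are adjacent to each other share their only
-- neighbour p_i.  If the path does not dominate the graph, some x at distance 2
-- from it is joined to it through a vertex v; then either x , v replace at most
-- one end vertex of the path to give a longer one, or the path around v
-- together with v and x induces M₂ or M₃.  So there is a dominating induced
-- path, along which an interval representation can be read off.
module Submission where

open import Defs
open import Data.Bool using (Bool; true; false; if_then_else_)
open import Data.Empty using (⊥-elim)
open import Data.Fin using (Fin; zero; suc; toℕ; fromℕ; fromℕ<; inject₁; #_)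
open import Data.Fin.Properties as Finₚ using (toℕ-injective; toℕ-fromℕ<; toℕ<n; all?)
open import Data.Nat using (ℕ; zero; suc; _+_; _*_; _∸_; _≤_; _<_; _≟_; _≤?_; _<?_; z≤n; s≤s; s≤s⁻¹)
open import Data.Nat.Properties
open import Data.Product using (∃-syntax; _×_; _,_; proj₁; proj₂)
open import Data.Sum using (_⊎_; inj₁; inj₂)
open import Data.Unit using (⊤; tt)
open import Data.Vec using (lookup; []; _∷_)
open import Function using (_∘_)
open import Function.Bundles using (_⇔_; mk⇔; Equivalence)
open import Level using (0ℓ)
open import Relation.Binary.Construct.Closure.ReflexiveTransitive using (Star; ε; _◅_; reverse)
open import Relation.Binary.Core using (Rel)
open import Relation.Binary.Definitions using (Decidable; tri<; tri≈; tri>)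
open import Relation.Binary.PropositionalEquality using (_≡_; _≢_; refl; sym; trans; cong; cong₂; subst)
open import Relation.Nullary using (¬_; Dec; yes; no; does)
open import Relation.Nullary.Decidable using (¬?; _×-dec_; _⊎-dec_; from-yes; True; False; toWitness; toWitnessFalse; map′)

open Equivalence using (to; from)

-- Straight grid paths

IsStep : ℕ → ℕ → ℕ → Set
IsStep t a b = (a ≡ t × b ≡ suc t) ⊎ (b ≡ t × a ≡ suc t)

-- The bounds around `f zero` are the induction hypothesis that ties a new first step to the range
-- of the remaining walk.
record Range (len : ℕ) (f : Fin (suc len) → ℕ) : Set where
  field
    lo hi  : ℕ
    lo≤f₀  : lo ≤ f zero
    f₀≤hi  : f zero ≤ hi
    within : ∀ i → ∃[ t ] (lo ≤ t × t < hi × IsStep t (f (inject₁ i)) (f (suc i)))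
    onto   : ∀ t → lo ≤ t → t < hi → ∃[ i ] IsStep t (f (inject₁ i)) (f (suc i))

-- A discrete intermediate value theorem: the unit steps taken by a walk on ℕ
-- are exactly those between its extreme values.
range : ∀ len (f : Fin (suc len) → ℕ) →
        (∀ i → ∃[ t ] IsStep t (f (inject₁ i)) (f (suc i))) → Range len f
range zero f step = record
  { lo = f zero ; hi = f zero ; lo≤f₀ = ≤-refl ; f₀≤hi = ≤-refl ; within = λ ()
  ; onto = λ t l h → ⊥-elim (<-irrefl refl (≤-<-trans l h)) }
range (suc len) f step = extend (step zero)
  where
  open Range (range len (f ∘ suc) (step ∘ suc))

  extend : ∃[ t ] IsStep t (f zero) (f (suc zero)) → Range (suc len) f
  extend (t , inj₁ (e₀ , e₁)) with lo ≤? t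
  ... | yes lo≤t = record
    { lo = lo ; hi = hi
    ; lo≤f₀ = subst (lo ≤_) (sym e₀) lo≤t
    ; f₀≤hi = subst (_≤ hi) (sym e₀) (<⇒≤ t<hi)
    ; within = λ { zero → t , lo≤t , t<hi , inj₁ (e₀ , e₁) ; (suc i) → within i }
    ; onto = λ s l h → let (i , p) = onto s l h in suc i , p }
    where
    t<hi : t < hi
    t<hi = subst (_≤ hi) e₁ f₀≤hi
  -- The remaining walk starts at `suc t`, so here `lo` is exactly `suc t` and the first step adds
  -- only the unit `t`.
  ... | no lo≰t = record
    { lo = t ; hi = hi
    ; lo≤f₀ = ≤-reflexive (sym e₀)
    ; f₀≤hi = subst (_≤ hi) (sym e₀) (<⇒≤ t<hi)
    ; within = λ { zero → t , ≤-refl , t<hi , inj₁ (e₀ , e₁)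
                 ; (suc i) → let (s , l , h , p) = within i in s , ≤-trans (<⇒≤ t<lo) l , h , p }
    ; onto = onto′ }
    where
    t<hi : t < hi
    t<hi = subst (_≤ hi) e₁ f₀≤hi
    t<lo : t < lo
    t<lo = ≰⇒> lo≰t
    onto′ : ∀ s → t ≤ s → s < hi → ∃[ i ] IsStep s (f (inject₁ i)) (f (suc i))
    onto′ s l h with m≤n⇒m<n∨m≡n l
    ... | inj₂ refl = zero , inj₁ (e₀ , e₁)
    ... | inj₁ t<s = let (i , p) = onto s (≤-trans (subst (lo ≤_) e₁ lo≤f₀) t<s) h in suc i , p
  extend (t , inj₂ (e₁ , e₀)) with suc t ≤? hi
  ... | yes t<hi = record
    { lo = lo ; hi = hi
    ; lo≤f₀ = subst (lo ≤_) (sym e₀) (m≤n⇒m≤1+n lo≤t)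
    ; f₀≤hi = subst (_≤ hi) (sym e₀) t<hi
    ; within = λ { zero → t , lo≤t , t<hi , inj₂ (e₁ , e₀) ; (suc i) → within i }
    ; onto = λ s l h → let (i , p) = onto s l h in suc i , p }
    where
    lo≤t : lo ≤ t
    lo≤t = subst (lo ≤_) e₁ lo≤f₀
  ... | no t≮hi = record
    { lo = lo ; hi = suc t
    ; lo≤f₀ = subst (lo ≤_) (sym e₀) (m≤n⇒m≤1+n lo≤t)
    ; f₀≤hi = ≤-reflexive e₀
    ; within = λ { zero → t , lo≤t , ≤-refl , inj₂ (e₁ , e₀)
                 ; (suc i) → let (s , l , h , p) = within i in s , l , <-≤-trans h hi≤1+t , p }
    ; onto = onto′ }
    where
    lo≤t : lo ≤ t
    lo≤t = subst (lo ≤_) e₁ lo≤f₀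
    hi≤1+t : hi ≤ suc t
    hi≤1+t = m≤n⇒m≤1+n (≮⇒≥ t≮hi)
    onto′ : ∀ s → lo ≤ s → s < suc t → ∃[ i ] IsStep s (f (inject₁ i)) (f (suc i))
    onto′ s l h with m≤n⇒m<n∨m≡n (s≤s⁻¹ h)
    ... | inj₂ refl = zero , inj₂ (e₁ , e₀)
    ... | inj₁ s<t = let (i , p) = onto s l (<-≤-trans s<t (subst (_≤ hi) e₁ f₀≤hi)) in suc i , p

consecutive⇒step : ∀ {k} {a b : Fin k} → Consecutive a b → ∃[ t ] IsStep t (toℕ a) (toℕ b)
consecutive⇒step {a = a} (inj₁ e) = toℕ a , inj₁ (refl , sym e)
consecutive⇒step {b = b} (inj₂ e) = toℕ b , inj₂ (refl , sym e)

Line : Set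
Line = Bool × ℕ

-- (true , r) is the row r and (false , c) the column c.
at : Line → ℕ → ℕ × ℕ
at (true  , r) t = r , t
at (false , c) t = t , c

module _ {rows cols : ℕ} where

  coords : Point rows cols → ℕ × ℕ
  coords (a , b) = toℕ a , toℕ b

  IsUnit : Line → ℕ → Rel (Point rows cols) 0ℓ
  IsUnit l t x y = (coords x ≡ at l t × coords y ≡ at l (suc t))
                 ⊎ (coords y ≡ at l t × coords x ≡ at l (suc t))

  isUnit-sym : ∀ {l t x y} → IsUnit l t x y → IsUnit l t y x
  isUnit-sym (inj₁ p) = inj₂ p
  isUnit-sym (inj₂ p) = inj₁ p

  coords-injective : ∀ {x y} → coords x ≡ coords y → x ≡ y
  coords-injective e = cong₂ _,_ (toℕ-injective (cong proj₁ e)) (toℕ-injective (cong proj₂ e))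

  at-parallel : ∀ l l′ {t t′} → at l t ≡ at l′ t′ → at l (suc t) ≡ at l′ (suc t′) → l ≡ l′ × t ≡ t′
  at-parallel (true  , _) (true  , _) refl refl = refl , refl
  at-parallel (true  , _) (false , _) refl ()
  at-parallel (false , _) (true  , _) refl ()
  at-parallel (false , _) (false , _) refl refl = refl , refl

  at-antiparallel : ∀ l l′ {t t′} → at l t ≡ at l′ (suc t′) → at l (suc t) ≢ at l′ t′
  at-antiparallel (true  , _) (true  , _) refl ()
  at-antiparallel (true  , _) (false , _) refl ()
  at-antiparallel (false , _) (true  , _) refl ()
  at-antiparallel (false , _) (false , _) refl ()

  -- The end points of a grid edge differ in one coordinate only, which fixes the line; opposite
  -- orientations would need `t` to be both larger and smaller than `t′`.
  isUnit-unique : ∀ {l l′ t t′ x y} → IsUnit l t x y → IsUnit l′ t′ x y → l ≡ l′ × t ≡ t′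
  isUnit-unique {l} {l′} (inj₁ (a , b)) (inj₁ (c , d)) = at-parallel l l′ (trans (sym a) c) (trans (sym b) d)
  isUnit-unique {l} {l′} (inj₂ (a , b)) (inj₂ (c , d)) = at-parallel l l′ (trans (sym a) c) (trans (sym b) d)
  isUnit-unique {l} {l′} (inj₁ (a , b)) (inj₂ (c , d)) = ⊥-elim (at-antiparallel l l′ (trans (sym a) d) (trans (sym b) c))
  isUnit-unique {l} {l′} (inj₂ (a , b)) (inj₁ (c , d)) = ⊥-elim (at-antiparallel l l′ (trans (sym a) d) (trans (sym b) c))

  isUnit⇒sameEdge : ∀ {l t x y x′ y′} → IsUnit l t x y → IsUnit l t x′ y′ →
                    (x ≡ x′ × y ≡ y′) ⊎ (x ≡ y′ × y ≡ x′)
  isUnit⇒sameEdge (inj₁ (a , b)) (inj₁ (c , d)) = inj₁ (coords-injective (trans a (sym c)) , coords-injective (trans b (sym d)))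
  isUnit⇒sameEdge (inj₂ (a , b)) (inj₂ (c , d)) = inj₁ (coords-injective (trans b (sym d)) , coords-injective (trans a (sym c)))
  isUnit⇒sameEdge (inj₁ (a , b)) (inj₂ (c , d)) = inj₂ (coords-injective (trans a (sym c)) , coords-injective (trans b (sym d)))
  isUnit⇒sameEdge (inj₂ (a , b)) (inj₁ (c , d)) = inj₂ (coords-injective (trans b (sym d)) , coords-injective (trans a (sym c)))

  -- Only the set of edges of the path is recorded, since `ShareEdge` depends on nothing else.
  record Segment (P : GridPath rows cols) : Set where
    field
      line   : Line
      lo hi  : ℕ
      lo<hi  : lo < hi
      within : ∀ i → ∃[ t ] (lo ≤ t × t < hi × IsUnit line t (source P i) (target P i))
      onto   : ∀ t → lo ≤ t → t < hi → ∃[ i ] IsUnit line t (source P i) (target P i)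

  toSegment : ∀ (P : GridPath rows cols) (l : Line) (c : Fin (suc (GridPath.len P)) → ℕ) →
              (∀ i → coords (GridPath.point P i) ≡ at l (c i)) →
              (∀ i → ∃[ t ] IsStep t (c (inject₁ i)) (c (suc i))) → Segment P
  toSegment P l c on steps = record
    { line = l ; lo = lo ; hi = hi
    ; lo<hi = let (_ , l , h , _) = within (fromℕ< 1≤len) in ≤-<-trans l h
    ; within = λ i → let (t , l , h , s) = within i in t , l , h , unit i s
    ; onto = λ t l h → let (i , s) = onto t l h in i , unit i s }
    where
    open GridPath P
    open Range (range len c steps)
    unit : ∀ i {t} → IsStep t (c (inject₁ i)) (c (suc i)) → IsUnit l t (source P i) (target P i)
    unit i (inj₁ (a , b)) = inj₁ (trans (on (inject₁ i)) (cong (at l) a) , trans (on (suc i)) (cong (at l) b))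
    unit i (inj₂ (a , b)) = inj₂ (trans (on (suc i)) (cong (at l) a) , trans (on (inject₁ i)) (cong (at l) b))

  Overlap : ∀ {P Q : GridPath rows cols} → Segment P → Segment Q → Set
  Overlap σ τ = σ.line ≡ τ.line × σ.lo < τ.hi × τ.lo < σ.hi
    where
    module σ = Segment σ
    module τ = Segment τ

  -- A shared edge has one position, which lies in both ranges. Conversely the unit starting at the
  -- larger of the two lower ends lies on both paths.
  share⇔overlap : ∀ {P Q : GridPath rows cols} (σ : Segment P) (τ : Segment Q) → ShareEdge P Q ⇔ Overlap σ τ
  share⇔overlap {P} {Q} σ τ = mk⇔ forth back
    where
    module σ = Segment σ
    module τ = Segment τ
    meet : ∀ {i j} → IsUnit σ.line (proj₁ (σ.within i)) (source Q j) (target Q j) → Overlap σ τ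
    meet {i} {j} u =
      let (t , a , b , _) = σ.within i
          (s , c , d , w) = τ.within j
          (l≡ , t≡s)      = isUnit-unique u w
      in l≡ , ≤-<-trans a (subst (_< τ.hi) (sym t≡s) d) , ≤-<-trans c (subst (_< σ.hi) t≡s b)
    forth : ShareEdge P Q → Overlap σ τ
    forth (i , j , inj₁ (a , b)) with proj₂ (proj₂ (proj₂ (σ.within i)))
    ... | u rewrite a | b = meet u
    forth (i , j , inj₂ (a , b)) with proj₂ (proj₂ (proj₂ (σ.within i)))
    ... | u rewrite a | b = meet (isUnit-sym u)
    back : Overlap σ τ → ShareEdge P Q
    back (l≡ , a , b) with ≤-total σ.lo τ.lo
    ... | inj₁ le =
      let (i , u) = σ.onto τ.lo le b ; (j , w) = τ.onto τ.lo ≤-refl τ.lo<hi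
      in i , j , isUnit⇒sameEdge (subst (λ l → IsUnit l _ _ _) l≡ u) w
    ... | inj₂ le =
      let (i , u) = σ.onto σ.lo ≤-refl σ.lo<hi ; (j , w) = τ.onto σ.lo le a
      in i , j , isUnit⇒sameEdge (subst (λ l → IsUnit l _ _ _) l≡ u) w

-- Induction in the form in which a grid path presents its steps, from `inject₁ i` to `suc i`.
∀-from-zero : ∀ {m} (Q : Fin (suc m) → Set) → Q zero → (∀ i → Q (inject₁ i) → Q (suc i)) → ∀ i → Q i
∀-from-zero {m} Q z s zero = z
∀-from-zero {suc m} Q z s (suc i) = s i (∀-from-zero (Q ∘ inject₁) z (s ∘ inject₁) i)

module _ {rows cols : ℕ} where

  segment : (P : GridPath rows cols) → ¬ HasBend P → Segment P
  segment P unbent = go (GridPath.len P) (GridPath.1≤len P) refl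
    where
    open GridPath P
    -- Matching the length as a successor makes `step zero` available. Its direction fixes the line,
    -- and a later step in the other direction would be a bend.
    go : ∀ m → 1 ≤ m → len ≡ m → Segment P
    go (suc m) _ refl with step zero
    ... | inj₁ h₀ = toSegment P (true , toℕ (proj₁ (point zero))) (toℕ ∘ proj₂ ∘ point)
        (∀-from-zero _ refl (λ i e → trans (cong (λ a → toℕ a , toℕ (proj₂ (point (suc i)))) (sym (proj₁ (horizontal i))))
                                           (cong (_, toℕ (proj₂ (point (suc i)))) (cong proj₁ e))))
        (consecutive⇒step ∘ proj₂ ∘ horizontal)
      where
      horizontal : ∀ i → Horizontal (source P i) (target P i)
      horizontal = ∀-from-zero _ h₀ λ i h → turn i h (step (suc i))
        where
        turn : ∀ i → Horizontal (source P (inject₁ i)) (target P (inject₁ i)) →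
               GridAdj (source P (suc i)) (target P (suc i)) → Horizontal (source P (suc i)) (target P (suc i))
        turn i h (inj₁ h′) = h′
        turn i h (inj₂ v) = ⊥-elim (unbent (inject₁ i , suc i , cong suc (Finₚ.toℕ-inject₁ i) , inj₁ (h , v)))
    ... | inj₂ v₀ = toSegment P (false , toℕ (proj₂ (point zero))) (toℕ ∘ proj₁ ∘ point)
        (∀-from-zero _ refl (λ i e → trans (cong (λ a → toℕ (proj₁ (point (suc i))) , toℕ a) (sym (proj₂ (vertical i))))
                                           (cong (toℕ (proj₁ (point (suc i))) ,_) (cong proj₂ e))))
        (consecutive⇒step ∘ proj₁ ∘ vertical)
      where
      vertical : ∀ i → Vertical (source P i) (target P i)
      vertical = ∀-from-zero _ v₀ λ i v → turn i v (step (suc i))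
        where
        turn : ∀ i → Vertical (source P (inject₁ i)) (target P (inject₁ i)) →
               GridAdj (source P (suc i)) (target P (suc i)) → Vertical (source P (suc i)) (target P (suc i))
        turn i v (inj₁ h) = ⊥-elim (unbent (inject₁ i , suc i , cong suc (Finₚ.toℕ-inject₁ i) , inj₂ (v , h)))
        turn i v (inj₂ v′) = v′

-- Interval graphs

-- Several lines are allowed, so disconnected graphs are covered. The inequalities are strict
-- because paths that only touch at an end point share no edge.
record IntervalModel {n} (G : Graph n) : Set where
  field
    line  : Fin n → Line
    lo hi : Fin n → ℕ
    lo<hi : ∀ v → lo v < hi v
    adj⇔  : ∀ u v → u ≢ v → Adj G u v ⇔ (line u ≡ line v × lo u < hi v × lo v < hi u)

B₀⇒model : ∀ {n} {G : Graph n} → B₀ G → IntervalModel G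
B₀⇒model (R , straight) = record
  { line = Segment.line ∘ σ ; lo = Segment.lo ∘ σ ; hi = Segment.hi ∘ σ ; lo<hi = λ v → Segment.lo<hi (σ v)
  ; adj⇔ = λ u v u≢v → let e = adj⇔share u v u≢v ; e′ = share⇔overlap (σ u) (σ v) in
                        mk⇔ (to e′ ∘ to e) (from e ∘ from e′) }
  where
  open EPGRepresentation R
  σ : ∀ v → Segment (path v)
  σ v = segment (path v) (straight v)

restrict : ∀ {m n} {H : Graph m} {G : Graph n} → H IsInducedSubgraphOf G → IntervalModel G → IntervalModel H
restrict (f , inj , iff) M = record
  { line = line ∘ f ; lo = lo ∘ f ; hi = hi ∘ f ; lo<hi = lo<hi ∘ f
  ; adj⇔ = λ u v u≢v → let e = adj⇔ (f u) (f v) (u≢v ∘ inj) in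
                        mk⇔ (to e ∘ to (iff u v)) (from (iff u v) ∘ from e) }
  where
  open IntervalModel M

argmin : ∀ {m} (f : Fin (suc m) → ℕ) → ∃[ i ] (∀ j → f i ≤ f j)
argmin {zero} f = zero , λ { zero → ≤-refl }
argmin {suc m} f with argmin (f ∘ suc)
... | i , min with f zero ≤? f (suc i)
...   | yes le = zero , λ { zero → ≤-refl ; (suc j) → ≤-trans le (min j) }
...   | no gt  = suc i , λ { zero → <⇒≤ (≰⇒> gt) ; (suc j) → min j }

adj⇒≢ : ∀ {n} (G : Graph n) {u v} → Adj G u v → u ≢ v
adj⇒≢ G a e = irrefl G e a

-- A witness that `v` is not a simplicial vertex.
record OpenNeighbours {n} (G : Graph n) (v : Fin n) : Set where
  field
    {a b}      : Fin n
    adj-a      : Adj G v a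
    adj-b      : Adj G v b
    a≢b        : a ≢ b
    nonadj-a-b : ¬ Adj G a b

-- The interval with the leftmost right end: its neighbours all contain its last unit.
model⇒simplicial : ∀ {n} {G : Graph (suc n)} → IntervalModel G → ∃[ v ] ¬ OpenNeighbours G v
model⇒simplicial {G = G} M = leftmost , simplicial
  where
  open IntervalModel M
  leftmost = proj₁ (argmin hi)
  min      = proj₂ (argmin hi)
  simplicial : ¬ OpenNeighbours G leftmost
  simplicial o = nonadj-a-b (from (adj⇔ a b a≢b) (trans (sym l) l′ , <-≤-trans x (min b) , <-≤-trans y (min a)))
    where
    open OpenNeighbours o
    meet-a = to (adj⇔ leftmost a (adj⇒≢ G adj-a)) adj-a
    meet-b = to (adj⇔ leftmost b (adj⇒≢ G adj-b)) adj-b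
    l  = proj₁ meet-a
    l′ = proj₁ meet-b
    x  = proj₂ (proj₂ meet-a)
    y  = proj₂ (proj₂ meet-b)

-- The witnesses are the two cyclic neighbours of `v`. The wrap-around in `Next` leads to three
-- cases: `v` is vertex 0, an inner vertex, or the last one.
C-openNeighbours : ∀ {r} → 4 ≤ r → (v : Fin r) → OpenNeighbours (C r) v
C-openNeighbours {suc (suc (suc (suc r)))} (s≤s (s≤s (s≤s (s≤s _)))) zero = record
  { a = suc zero ; b = last
  ; adj-a = (λ ()) , inj₁ (inj₁ refl)
  ; adj-b = (λ ()) , inj₂ (inj₂ (cong suc toℕ-last , refl))
  ; a≢b = λ ()
  ; nonadj-a-b = λ { (_ , inj₁ (inj₁ e)) → 1+n≢0 (sym (suc-injective (suc-injective (trans e toℕ-last))))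
                   ; (_ , inj₁ (inj₂ ())) ; (_ , inj₂ (inj₁ e)) → 1+n≢0 (suc-injective (trans (sym (cong suc toℕ-last)) e))
                   ; (_ , inj₂ (inj₂ (_ , ()))) } }
  where
  last : Fin (4 + r)
  last = suc (suc (suc (fromℕ r)))
  toℕ-last : toℕ last ≡ 3 + r
  toℕ-last = cong (3 +_) (Finₚ.toℕ-fromℕ r)
C-openNeighbours {suc zero} (s≤s ()) zero
C-openNeighbours {suc (suc zero)} (s≤s (s≤s ())) zero
C-openNeighbours {suc (suc (suc zero))} (s≤s (s≤s (s≤s ()))) zero
C-openNeighbours {suc r} 4≤r (suc i) with suc (suc (toℕ i)) <? suc r
... | yes lt = record
  { a = inject₁ i ; b = fromℕ< lt
  ; adj-a = (λ e → 1+n≢n (trans (cong toℕ e) ia)) , inj₂ (inj₁ (cong suc ia))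
  ; adj-b = (λ e → 1+n≢n (sym (trans (cong toℕ e) ib))) , inj₁ (inj₁ (sym ib))
  ; a≢b = λ e → <-irrefl (trans (sym ia) (trans (cong toℕ e) ib)) (m<n+m (toℕ i) {2} (s≤s z≤n))
  ; nonadj-a-b = λ
    { (_ , inj₁ (inj₁ e)) → 1+n≢n (sym (trans (sym (cong suc ia)) (trans e ib)))
    ; (_ , inj₁ (inj₂ (_ , e))) → 1+n≢0 (trans (sym ib) e)
    ; (_ , inj₂ (inj₁ e)) → <-irrefl (sym (trans (sym (cong suc ib)) (trans e ia))) (m<n+m (toℕ i) {3} (s≤s z≤n))
    ; (_ , inj₂ (inj₂ (e , e′))) → <-irrefl (trans (cong (3 +_) (trans (sym e′) ia)) (trans (sym (cong suc ib)) e)) 4≤r } }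
  where
  ia = Finₚ.toℕ-inject₁ i
  ib = toℕ-fromℕ< lt
-- `suc i` is the last vertex, so its successor is `zero`.
... | no ge = record
  { a = inject₁ i ; b = zero
  ; adj-a = (λ e → 1+n≢n (trans (cong toℕ e) ia)) , inj₂ (inj₁ (cong suc ia))
  ; adj-b = (λ ()) , inj₁ (inj₂ (cong suc 1+i≡r , refl))
  ; a≢b = λ e → <-irrefl (trans (cong (2 +_) (trans (sym (cong toℕ e)) ia)) (cong suc 1+i≡r)) (<⇒≤ 4≤r)
  ; nonadj-a-b = λ
    { (_ , inj₁ (inj₁ ()))
    ; (_ , inj₁ (inj₂ (e , _))) → 1+n≢n (trans (cong suc 1+i≡r) (trans (sym e) (cong suc ia)))
    ; (_ , inj₂ (inj₁ e)) → <-irrefl (trans (cong (2 +_) (trans e ia)) (cong suc 1+i≡r)) 4≤r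
    ; (_ , inj₂ (inj₂ (e , _))) → <-irrefl e (≤-trans (s≤s (s≤s z≤n)) 4≤r) } }
  where
  ia = Finₚ.toℕ-inject₁ i
  1+i≡r : suc (toℕ i) ≡ r
  1+i≡r = ≤-antisym (toℕ<n i) (s≤s⁻¹ (≮⇒≥ ge))

cycle-not-interval : ∀ {r} → 4 ≤ r → ¬ IntervalModel (C r)
cycle-not-interval {suc r} 4≤r M = let (v , s) = model⇒simplicial M in s (C-openNeighbours 4≤r v)

-- Asteroidal triples

module _ {n} (G : Graph n) where

  Clear : Fin n → Fin n → Set
  Clear v x = v ≢ x × ¬ Adj G v x

  Avoiding : Fin n → Rel (Fin n) 0ℓ
  Avoiding v x y = Adj G x y × Clear v x × Clear v y

  clear? : Decidable Clear
  clear? v x = ¬? (v Finₚ.≟ x) ×-dec ¬? (adj? G v x)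

  avoiding? : ∀ v → Decidable (Avoiding v)
  avoiding? v x y = adj? G x y ×-dec clear? v x ×-dec clear? v y

  module _ (M : IntervalModel G) where
    open IntervalModel M

    Left : Rel (Fin n) 0ℓ
    Left x v = line x ≡ line v × hi x ≤ lo v

    left-asym : ∀ {x y} → Left x y → ¬ Left y x
    left-asym {x} {y} (_ , a) (_ , b) =
      <-irrefl refl (<-≤-trans (lo<hi x) (≤-trans a (≤-trans (<⇒≤ (lo<hi y)) b)))

    sides : ∀ {x v} → Clear v x → line x ≡ line v → Left x v ⊎ Left v x
    sides {x} {v} (v≢x , ¬adj) l with hi x ≤? lo v | hi v ≤? lo x
    ... | yes a | _     = inj₁ (l , a)
    ... | no _  | yes b = inj₂ (sym l , b)
    ... | no a  | no b  = ⊥-elim (¬adj (from (adj⇔ v x v≢x) (sym l , ≰⇒> a , ≰⇒> b)))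

    -- If `y` lay to the right of `v`, it would start no earlier than `hi v`, whereas it must start
    -- before `hi x`, which is at most `lo v`.
    left-step : ∀ {v x y} → Avoiding v x y → Left x v → Left y v
    left-step {v} {x} {y} (a , _ , cy) (l , h)
      with to (adj⇔ x y (adj⇒≢ G a)) a
    ... | l′ , _ , y<x with sides cy (trans (sym l′) l)
    ...   | inj₁ p = p
    ...   | inj₂ (_ , q) = ⊥-elim (<-irrefl refl
              (<-≤-trans y<x (≤-trans h (≤-trans (<⇒≤ (lo<hi v)) q))))

    left-walk : ∀ {v x y} → Star (Avoiding v) x y → Left x v → Left y v
    left-walk ε       l = l
    left-walk (s ◅ w) l = left-walk w (left-step s l)

    line-walk : ∀ {v x y} → Star (Avoiding v) x y → line x ≡ line y
    line-walk ε = refl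
    line-walk ((a , _) ◅ w) = trans (proj₁ (to (adj⇔ _ _ (adj⇒≢ G a)) a)) (line-walk w)

  record AsteroidalTriple : Set where
    field
      a b c : Fin n
      a≁b   : Clear a b
      a≁c   : Clear a c
      b≁c   : Clear b c
      ab    : Star (Avoiding c) a b
      ac    : Star (Avoiding b) a c
      bc    : Star (Avoiding a) b c

  -- A walk avoiding the closed neighbourhood of v stays on one side of v, so
  -- none of the three intervals can be the middle one.
  asteroidal-not-interval : AsteroidalTriple → ¬ IntervalModel G
  asteroidal-not-interval T M = cases (sides M a≁b (sym (line-walk M ab)))
    where
    open AsteroidalTriple T
    back : ∀ {v x y} → Star (Avoiding v) x y → Star (Avoiding v) y x
    back = reverse λ { (e , cx , cy) → symm G e , cy , cx }
    cases : ¬ (Left M b a ⊎ Left M a b)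
    cases (inj₁ b<a) with sides M b≁c (sym (line-walk M bc))
    ... | inj₁ c<b = left-asym M b<a (left-walk M (back ac) c<b)
    -- With `b` left of both others, the walk from `b` to `c` puts `c` left of `a`, and the walk
    -- from `b` to `a` puts `a` left of `c`.
    ... | inj₂ b<c = left-asym M (left-walk M bc b<a) (left-walk M (back ab) b<c)
    cases (inj₂ a<b) with sides M a≁c (sym (line-walk M ac))
    ... | inj₁ c<a = left-asym M a<b (left-walk M (back bc) c<a)
    ... | inj₂ a<c = left-asym M (left-walk M ac a<b) (left-walk M ab a<c)

-- The three leaves: a walk between two of them through the centre misses the third leaf and its
-- only neighbour.
M₂-asteroidal : AsteroidalTriple M₂
M₂-asteroidal = record
  { a = # 4 ; b = # 5 ; c = # 6
  ; a≁b = from-yes (clear? M₂ (# 4) (# 5))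
  ; a≁c = from-yes (clear? M₂ (# 4) (# 6))
  ; b≁c = from-yes (clear? M₂ (# 5) (# 6))
  ; ab = from-yes (avoiding? M₂ (# 6) (# 4) (# 1)) ◅ from-yes (avoiding? M₂ (# 6) (# 1) (# 0))
       ◅ from-yes (avoiding? M₂ (# 6) (# 0) (# 2)) ◅ from-yes (avoiding? M₂ (# 6) (# 2) (# 5)) ◅ ε
  ; ac = from-yes (avoiding? M₂ (# 5) (# 4) (# 1)) ◅ from-yes (avoiding? M₂ (# 5) (# 1) (# 0))
       ◅ from-yes (avoiding? M₂ (# 5) (# 0) (# 3)) ◅ from-yes (avoiding? M₂ (# 5) (# 3) (# 6)) ◅ ε
  ; bc = from-yes (avoiding? M₂ (# 4) (# 5) (# 2)) ◅ from-yes (avoiding? M₂ (# 4) (# 2) (# 0))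
       ◅ from-yes (avoiding? M₂ (# 4) (# 0) (# 3)) ◅ from-yes (avoiding? M₂ (# 4) (# 3) (# 6)) ◅ ε }

-- The three pendant vertices: a walk between two of them needs only one edge of the triangle and
-- misses its third corner.
M₃-asteroidal : AsteroidalTriple M₃
M₃-asteroidal = record
  { a = # 3 ; b = # 4 ; c = # 5
  ; a≁b = from-yes (clear? M₃ (# 3) (# 4))
  ; a≁c = from-yes (clear? M₃ (# 3) (# 5))
  ; b≁c = from-yes (clear? M₃ (# 4) (# 5))
  ; ab = from-yes (avoiding? M₃ (# 5) (# 3) (# 0)) ◅ from-yes (avoiding? M₃ (# 5) (# 0) (# 1))
       ◅ from-yes (avoiding? M₃ (# 5) (# 1) (# 4)) ◅ ε
  ; ac = from-yes (avoiding? M₃ (# 4) (# 3) (# 0)) ◅ from-yes (avoiding? M₃ (# 4) (# 0) (# 2))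
       ◅ from-yes (avoiding? M₃ (# 4) (# 2) (# 5)) ◅ ε
  ; bc = from-yes (avoiding? M₃ (# 3) (# 4) (# 1)) ◅ from-yes (avoiding? M₃ (# 3) (# 1) (# 2))
       ◅ from-yes (avoiding? M₃ (# 3) (# 2) (# 5)) ◅ ε }

-- Diamonds in cacti

module _ {n} (G : Graph n) where

  triangle : ∀ {u v w} → Adj G u v → Adj G v w → Adj G w u → SimpleCycle G
  triangle {u} {v} {w} uv vw wu = record
    { size = 3 ; 3≤size = ≤-refl ; vertex = corner ; distinct = injective _ _ ; step = step }
    where
    corner : Fin 3 → Fin n
    corner zero = u
    corner (suc zero) = v
    corner (suc (suc zero)) = w
    injective : ∀ i j → corner i ≡ corner j → i ≡ j
    injective zero zero e = refl
    injective zero (suc zero) e = ⊥-elim (irrefl G e uv)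
    injective zero (suc (suc zero)) e = ⊥-elim (irrefl G (sym e) wu)
    injective (suc zero) zero e = ⊥-elim (irrefl G (sym e) uv)
    injective (suc zero) (suc zero) e = refl
    injective (suc zero) (suc (suc zero)) e = ⊥-elim (irrefl G e vw)
    injective (suc (suc zero)) zero e = ⊥-elim (irrefl G e wu)
    injective (suc (suc zero)) (suc zero) e = ⊥-elim (irrefl G (sym e) vw)
    injective (suc (suc zero)) (suc (suc zero)) e = refl
    step : ∀ i j → Next i j → Adj G (corner i) (corner j)
    step zero zero (inj₂ ())
    step zero (suc zero) _ = uv
    step zero (suc (suc zero)) (inj₁ ())
    step zero (suc (suc zero)) (inj₂ ())
    step (suc zero) zero (inj₂ ())
    step (suc zero) (suc zero) (inj₁ ())
    step (suc zero) (suc zero) (inj₂ ())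
    step (suc zero) (suc (suc zero)) _ = vw
    step (suc (suc zero)) zero _ = wu
    step (suc (suc zero)) (suc zero) (inj₁ ())
    step (suc (suc zero)) (suc zero) (inj₂ ())
    step (suc (suc zero)) (suc (suc zero)) (inj₁ ())
    step (suc (suc zero)) (suc (suc zero)) (inj₂ ())

  -- No edge lies in two triangles. The diamond is excluded as a subgraph, not only as an induced
  -- one, so complete graphs on four vertices are excluded too.
  DiamondFree : Set
  DiamondFree = ∀ {u v w x} → Adj G u v → Adj G u w → Adj G v w → Adj G u x → Adj G v x → w ≡ x

  -- If `w ≢ x`, the triangles `u v w` and `u v x` are different cycles, as `w` lies on the first
  -- only. They meet in both `u` and `v`, so the cactus condition identifies these two adjacent
  -- vertices.
  cactus⇒diamondFree : Cactus G → DiamondFree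
  cactus⇒diamondFree (_ , meet) {u} {v} {w} {x} uv uw vw ux vx with w Finₚ.≟ x
  ... | yes e = e
  ... | no w≢x = ⊥-elim (irrefl G u≡v uv)
    where
    c d : SimpleCycle G
    c = triangle uv vw (symm G uw)
    d = triangle uv vx (symm G ux)
    w∉d : ¬ (_∈ᵛ_ {G = G} w d)
    w∉d (zero , e) = irrefl G e uw
    w∉d (suc zero , e) = irrefl G e vw
    w∉d (suc (suc zero) , e) = w≢x (sym e)
    edge⇒∈ : ∀ {a b} → HasEdge {G = G} d a b → _∈ᵛ_ {G = G} b d
    edge⇒∈ (i , j , _ , inj₁ (_ , e)) = j , e
    edge⇒∈ (i , j , _ , inj₂ (e , _)) = i , e
    differ : ¬ SameCycle {G = G} c d
    differ same = w∉d (edge⇒∈ (to (same v w) (# 1 , # 2 , inj₁ refl , inj₁ (refl , refl))))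
    u≡v : u ≡ v
    u≡v = meet c d differ u v (# 0 , refl) (# 0 , refl) (# 1 , refl) (# 1 , refl)

-- Induced paths

module _ {n} (G : Graph n) where

  -- Only the values of p at 0 , … , k matter.
  record InducedPath (k : ℕ) (p : ℕ → Fin n) : Set where
    field
      distinct  : ∀ {i j} → i < j → j ≤ k → p i ≢ p j
      edge      : ∀ {i} → i < k → Adj G (p i) (p (suc i))
      chordless : ∀ {i j} → i < j → j ≤ k → Adj G (p i) (p j) → j ≡ suc i

  open InducedPath

  OffPath : ℕ → (ℕ → Fin n) → Fin n → Set
  OffPath k p v = ∀ i → i ≤ k → p i ≢ v

  takePath : ∀ {k j p} → j ≤ k → InducedPath k p → InducedPath j p
  takePath j≤k P = record
    { distinct  = λ l h → distinct P l (≤-trans h j≤k)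
    ; edge      = λ l → edge P (<-≤-trans l j≤k)
    ; chordless = λ l h → chordless P l (≤-trans h j≤k) }

  dropPath : ∀ m {k p} → InducedPath (m + k) p → InducedPath k (p ∘ (m +_))
  dropPath m {k} {p} P = record
    { distinct  = λ l h → distinct P (+-monoʳ-< m l) (+-monoʳ-≤ m h)
    ; edge      = λ {i} l → subst (λ t → Adj G (p (m + i)) (p t)) (sym (+-suc m i)) (edge P (+-monoʳ-< m l))
    ; chordless = λ {i} l h a → +-cancelˡ-≡ m _ _
        (trans (chordless P (+-monoʳ-< m l) (+-monoʳ-≤ m h) a) (sym (+-suc m i))) }

  reversePath : ∀ {k p} → InducedPath k p → InducedPath k (p ∘ (k ∸_))
  reversePath {k} {p} P = record
    { distinct  = λ {i} l h e → distinct P (∸-monoʳ-< l h) (m∸n≤m k i) (sym e)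
    ; edge      = λ {i} l → symm G (subst (λ t → Adj G (p (k ∸ suc i)) (p t)) (suc-∸ l)
        (edge P (subst (_≤ k) (sym (suc-∸ l)) (m∸n≤m k i))))
    ; chordless = λ {i} {j} l h a → sym (∸-cancelˡ-≡ (≤-trans l h) h
        (suc-injective (trans (suc-∸ (≤-trans l h)) (chordless P (∸-monoʳ-< l h) (m∸n≤m k i) (symm G a))))) }
    where
    suc-∸ : ∀ {i} → i < k → suc (k ∸ suc i) ≡ k ∸ i
    suc-∸ l = sym (+-∸-assoc 1 l)

  off-reverse : ∀ {k p v} → OffPath k p v → OffPath k (p ∘ (k ∸_)) v
  off-reverse {k} off i _ = off (k ∸ i) (m∸n≤m k i)

  cons : Fin n → (ℕ → Fin n) → ℕ → Fin n
  cons x p zero    = x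
  cons x p (suc i) = p i

  off-cons : ∀ {k p v x} → x ≢ v → OffPath k p v → OffPath (suc k) (cons x p) v
  off-cons x≢v off zero    _ = x≢v
  off-cons x≢v off (suc i) h = off i (s≤s⁻¹ h)

  consPath : ∀ {k p x} → InducedPath k p → OffPath k p x → Adj G x (p 0) →
             (∀ i → suc i ≤ k → ¬ Adj G x (p (suc i))) → InducedPath (suc k) (cons x p)
  consPath {k} {p} {x} P off a far = record { distinct = distinct′ ; edge = edge′ ; chordless = chordless′ }
    where
    distinct′ : ∀ {i j} → i < j → j ≤ suc k → cons x p i ≢ cons x p j
    distinct′ {zero}  {suc j} _ h e = off j (s≤s⁻¹ h) (sym e)
    distinct′ {suc i} {suc j} l h   = distinct P (s≤s⁻¹ l) (s≤s⁻¹ h)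
    edge′ : ∀ {i} → i < suc k → Adj G (cons x p i) (p i)
    edge′ {zero}  _ = a
    edge′ {suc i} l = edge P (s≤s⁻¹ l)
    chordless′ : ∀ {i j} → i < j → j ≤ suc k → Adj G (cons x p i) (cons x p j) → j ≡ suc i
    chordless′ {zero}  {suc zero}    _ h e = refl
    chordless′ {zero}  {suc (suc j)} _ h e = ⊥-elim (far j (s≤s⁻¹ h) e)
    chordless′ {suc i} {suc j} l h e = cong suc (chordless P (s≤s⁻¹ l) (s≤s⁻¹ h) e)

  path-bound : ∀ {k p} → InducedPath k p → k < n
  path-bound {k} {p} P = Finₚ.injective⇒≤ {f = p ∘ toℕ} inj
    where
    inj : ∀ {i j : Fin (suc k)} → p (toℕ i) ≡ p (toℕ j) → i ≡ j
    inj {i} {j} e with <-cmp (toℕ i) (toℕ j)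
    ... | tri< l _ _ = ⊥-elim (distinct P l (s≤s⁻¹ (toℕ<n j)) e)
    ... | tri≈ _ q _ = toℕ-injective q
    ... | tri> _ _ l = ⊥-elim (distinct P l (s≤s⁻¹ (toℕ<n i)) (sym e))

  pathAdj : ∀ {k p} → InducedPath k p → ∀ {i j} → i ≤ k → j ≤ k →
            Adj G (p i) (p j) ⇔ (suc i ≡ j ⊎ suc j ≡ i)
  pathAdj {k} {p} P {i} {j} i≤k j≤k = mk⇔ forth back
    where
    forth : Adj G (p i) (p j) → suc i ≡ j ⊎ suc j ≡ i
    forth a with <-cmp i j
    ... | tri< l _ _ = inj₁ (sym (chordless P l j≤k a))
    ... | tri≈ _ q _ = ⊥-elim (irrefl G (cong p q) a)
    ... | tri> _ _ l = inj₂ (sym (chordless P l i≤k (symm G a)))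
    back : suc i ≡ j ⊎ suc j ≡ i → Adj G (p i) (p j)
    back (inj₁ refl) = edge P j≤k
    back (inj₂ refl) = symm G (edge P i≤k)

  -- Vertex 0 of the cycle goes to `x` and vertex `i + 1` to `q i`; the edge from `x` to `q k`
  -- realises the wrap-around.
  closed-path : ∀ {k q x} → InducedPath k q → OffPath k q x →
                Adj G x (q 0) → Adj G x (q k) → (∀ i → 0 < i → i < k → ¬ Adj G x (q i)) →
                C (2 + k) IsInducedSubgraphOf G
  closed-path {k} {q} {x} P off a b far = f , (λ {i} {j} → inj i j) , iff
    where
    f : Fin (2 + k) → Fin n
    f = cons x q ∘ toℕ
    inj : ∀ i j → f i ≡ f j → i ≡ j
    inj zero    zero    e = refl
    inj zero    (suc j) e = ⊥-elim (off (toℕ j) (s≤s⁻¹ (toℕ<n j)) (sym e))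
    inj (suc i) zero    e = ⊥-elim (off (toℕ i) (s≤s⁻¹ (toℕ<n i)) e)
    inj (suc i) (suc j) e with <-cmp (toℕ i) (toℕ j)
    ... | tri< l _ _ = ⊥-elim (distinct P l (s≤s⁻¹ (toℕ<n j)) e)
    ... | tri≈ _ r _ = cong suc (toℕ-injective r)
    ... | tri> _ _ l = ⊥-elim (distinct P l (s≤s⁻¹ (toℕ<n i)) (sym e))
    tip : ∀ j → Adj (C (2 + k)) zero (suc j) ⇔ Adj G x (q (toℕ j))
    tip j = mk⇔ forth back
      where
      forth : Adj (C (2 + k)) zero (suc j) → Adj G x (q (toℕ j))
      forth (_ , inj₁ (inj₁ e)) = subst (Adj G x ∘ q) (suc-injective e) a
      forth (_ , inj₂ (inj₂ (e , _))) = subst (Adj G x ∘ q) (sym (suc-injective (suc-injective e))) b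
      back : Adj G x (q (toℕ j)) → Adj (C (2 + k)) zero (suc j)
      back e with toℕ j ≟ 0 | toℕ j ≟ k
      ... | yes z | _     = (λ ()) , inj₁ (inj₁ (cong suc (sym z)))
      ... | no _  | yes z = (λ ()) , inj₂ (inj₂ (cong (2 +_) z , refl))
      ... | no z  | no z′ = ⊥-elim (far (toℕ j) (n≢0⇒n>0 z) (≤∧≢⇒< (s≤s⁻¹ (toℕ<n j)) z′) e)
    swapped : ∀ {m} (H : Graph m) {i j} {u v} → Adj H i j ⇔ Adj G u v → Adj H j i ⇔ Adj G v u
    swapped H e = mk⇔ (symm G ∘ to e ∘ symm H) (symm H ∘ from e ∘ symm G)
    iff : ∀ i j → Adj (C (2 + k)) i j ⇔ Adj G (f i) (f j)
    iff zero zero = mk⇔ (λ { (z , _) → ⊥-elim (z refl) }) (λ e → ⊥-elim (irrefl G refl e))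
    iff zero (suc j) = tip j
    iff (suc i) zero = swapped (C (2 + k)) (tip i)
    iff (suc i) (suc j) = mk⇔ forth back
      where
      link = pathAdj P (s≤s⁻¹ (toℕ<n i)) (s≤s⁻¹ (toℕ<n j))
      forth : Adj (C (2 + k)) (suc i) (suc j) → Adj G (q (toℕ i)) (q (toℕ j))
      forth (_ , inj₁ (inj₁ e)) = from link (inj₁ (suc-injective e))
      forth (_ , inj₂ (inj₁ e)) = from link (inj₂ (suc-injective e))
      back : Adj G (q (toℕ i)) (q (toℕ j)) → Adj (C (2 + k)) (suc i) (suc j)
      back e = adj⇒≢ G e ∘ cong f , next (to link e)
        where
        next : suc (toℕ i) ≡ toℕ j ⊎ suc (toℕ j) ≡ toℕ i → Next (suc i) (suc j) ⊎ Next (suc j) (suc i)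
        next (inj₁ z) = inj₁ (inj₁ (cong suc z))
        next (inj₂ z) = inj₂ (inj₁ (cong suc z))

-- Recognising small induced subgraphs

-- The part of a relation above the diagonal as a nested product, so that an embedding can be given
-- as a table, row by row.
Upper : ∀ {m} → (Fin m → Fin m → Set) → Set
Upper {zero}  R = ⊤
Upper {suc m} R = (∀ j → R zero (suc j)) × Upper (λ i j → R (suc i) (suc j))

upper-lookup : ∀ {m} {R : Fin m → Fin m → Set} → Upper R → ∀ i j → toℕ i < toℕ j → R i j
upper-lookup (r , _) zero    (suc j) _ = r j
upper-lookup (_ , u) (suc i) (suc j) l = upper-lookup u i j (s≤s⁻¹ l)

module _ {m n} (H : Graph m) (G : Graph n) where

  -- For a concrete `H` the decision evaluates, and each table entry has the type of an adjacency or
  -- of a `Clear` pair.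
  Matches : (Fin m → Fin n) → Fin m → Fin m → Set
  Matches f i j = if does (adj? H i j) then Adj G (f i) (f j) else Clear G (f i) (f j)

  matches⇒ : ∀ {f} i j → Matches f i j → f i ≢ f j × (Adj H i j ⇔ Adj G (f i) (f j))
  matches⇒ i j match with adj? H i j | match
  ... | yes h | a         = adj⇒≢ G a , mk⇔ (λ _ → a) (λ _ → h)
  ... | no ¬h | (ne , ¬a) = ne , mk⇔ (⊥-elim ∘ ¬h) (⊥-elim ∘ ¬a)

  upper⇒induced : ∀ f → Upper (Matches f) → H IsInducedSubgraphOf G
  upper⇒induced f u = f , inj , iff
    where
    pair : ∀ i j → toℕ i < toℕ j → f i ≢ f j × (Adj H i j ⇔ Adj G (f i) (f j))
    pair i j l = matches⇒ i j (upper-lookup u i j l)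
    inj : ∀ {i j} → f i ≡ f j → i ≡ j
    inj {i} {j} e with <-cmp (toℕ i) (toℕ j)
    ... | tri< l _ _ = ⊥-elim (proj₁ (pair i j l) e)
    ... | tri≈ _ q _ = toℕ-injective q
    ... | tri> _ _ l = ⊥-elim (proj₁ (pair j i l) (sym e))
    iff : ∀ i j → Adj H i j ⇔ Adj G (f i) (f j)
    iff i j with <-cmp (toℕ i) (toℕ j)
    ... | tri< l _ _ = proj₂ (pair i j l)
    ... | tri≈ _ q _ = mk⇔ (⊥-elim ∘ irrefl H (toℕ-injective q)) (⊥-elim ∘ irrefl G (cong f (toℕ-injective q)))
    ... | tri> _ _ l = let e = proj₂ (pair j i l) in
                       mk⇔ (symm G ∘ to e ∘ symm H) (symm H ∘ from e ∘ symm G)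

module _ {n} (G : Graph n) where
  open InducedPath

  clear-sym : ∀ {u v} → Clear G u v → Clear G v u
  clear-sym (ne , ¬a) = ne ∘ sym , ¬a ∘ symm G

  -- For numerals the implicit side conditions are settled by evaluation.
  path-clear : ∀ {k p} → InducedPath G k p → ∀ i j {_ : True (i <? j)} {_ : True (j ≤? k)} {_ : False (j ≟ suc i)} →
               Clear G (p i) (p j)
  path-clear {k} P i j {l} {h} {ne} =
    distinct P i<j j≤k , λ a → toWitnessFalse {a? = j ≟ suc i} ne (chordless P i<j j≤k a)
    where
    i<j = toWitness {a? = i <? j} l
    j≤k = toWitness {a? = j ≤? k} h

  -- The centre is `q 2`, with the three legs `q 1`, `q 0` and `q 3`, `q 4` and `v`, `x`.
  path⇒M₂ : ∀ {q v x} → InducedPath G 4 q → OffPath G 4 q v → (∀ i → i ≤ 4 → Clear G (q i) x) → Adj G v x →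
            Adj G v (q 2) → (∀ i → i ≤ 4 → i ≢ 2 → ¬ Adj G v (q i)) →
            M₂ IsInducedSubgraphOf G
  path⇒M₂ {q} {v} {x} Q offv clearx vx v2 vfar =
    upper⇒induced M₂ G (lookup (q 2 ∷ q 1 ∷ q 3 ∷ v ∷ q 0 ∷ q 4 ∷ x ∷ []))
    ( (λ where
        zero → symm G (edge Q (from-yes (1 <? 4)))
        (suc zero) → edge Q (from-yes (2 <? 4))
        (suc (suc zero)) → symm G v2
        (suc (suc (suc zero))) → clear-sym (path-clear Q 0 2)
        (suc (suc (suc (suc zero)))) → path-clear Q 2 4
        (suc (suc (suc (suc (suc zero))))) → qx 2)
    , (λ where
        zero → path-clear Q 1 3
        (suc zero) → qv 1
        (suc (suc zero)) → symm G (edge Q (from-yes (0 <? 4)))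
        (suc (suc (suc zero))) → path-clear Q 1 4
        (suc (suc (suc (suc zero)))) → qx 1)
    , (λ where
        zero → qv 3
        (suc zero) → clear-sym (path-clear Q 0 3)
        (suc (suc zero)) → edge Q (from-yes (3 <? 4))
        (suc (suc (suc zero))) → qx 3)
    , (λ where
        zero → clear-sym (qv 0)
        (suc zero) → clear-sym (qv 4)
        (suc (suc zero)) → vx)
    , (λ where
        zero → path-clear Q 0 4
        (suc zero) → qx 0)
    , (λ where zero → qx 4)
    , (λ ()) , tt)
    where
    qv : ∀ i {_ : True (i ≤? 4)} {_ : False (i ≟ 2)} → Clear G (q i) v
    qv i {h} {ne} = offv i (toWitness {a? = i ≤? 4} h) ,
                    vfar i (toWitness {a? = i ≤? 4} h) (toWitnessFalse {a? = i ≟ 2} ne) ∘ symm G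
    qx : ∀ i {_ : True (i ≤? 4)} → Clear G (q i) x
    qx i {h} = clearx i (toWitness {a? = i ≤? 4} h)

  -- The triangle is `q 1`, `q 2`, `v`, with pendant vertices `q 0`, `q 3`, `x`.
  path⇒M₃ : ∀ {q v x} → InducedPath G 3 q → OffPath G 3 q v → (∀ i → i ≤ 3 → Clear G (q i) x) → Adj G v x →
            Adj G v (q 1) → Adj G v (q 2) → ¬ Adj G v (q 0) → ¬ Adj G v (q 3) →
            M₃ IsInducedSubgraphOf G
  path⇒M₃ {q} {v} {x} Q offv clearx vx v1 v2 ¬v0 ¬v3 =
    upper⇒induced M₃ G (lookup (q 1 ∷ q 2 ∷ v ∷ q 0 ∷ q 3 ∷ x ∷ []))
    ( (λ where
        zero → edge Q (from-yes (1 <? 3))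
        (suc zero) → symm G v1
        (suc (suc zero)) → symm G (edge Q (from-yes (0 <? 3)))
        (suc (suc (suc zero))) → path-clear Q 1 3
        (suc (suc (suc (suc zero)))) → qx 1)
    , (λ where
        zero → symm G v2
        (suc zero) → clear-sym (path-clear Q 0 2)
        (suc (suc zero)) → edge Q (from-yes (2 <? 3))
        (suc (suc (suc zero))) → qx 2)
    , (λ where
        zero → offv 0 z≤n ∘ sym , ¬v0
        (suc zero) → offv 3 ≤-refl ∘ sym , ¬v3
        (suc (suc zero)) → vx)
    , (λ where
        zero → path-clear Q 0 3
        (suc zero) → qx 0)
    , (λ where zero → qx 3)
    , (λ ()) , tt)
    where
    qx : ∀ i {_ : True (i ≤? 3)} → Clear G (q i) x
    qx i {h} = clearx i (toWitness {a? = i ≤? 3} h)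

-- Neighbours of an induced path

module Chordal {n} (G : Graph n)
  (noCycle : ∀ r → 4 ≤ r → ¬ (C r IsInducedSubgraphOf G)) (diamondFree : DiamondFree G) where

  open InducedPath

  -- Induction on the length of the path, with `b` as fuel. If `v` has no inner neighbour, an
  -- induced cycle on `4 + d` vertices arises; an inner neighbour gives a shorter closed path, down
  -- to length 2, where two triangles share the edge from `v` to `q 1`.
  closed-path-absurd : ∀ b d {q v} → d < b → InducedPath G (2 + d) q → OffPath G (2 + d) q v →
                       Adj G v (q 0) → ¬ Adj G v (q (2 + d))
  closed-path-absurd (suc b) d {q} {v} lt Q off a z with anyUpTo? (λ t → adj? G v (q (suc t))) (suc d)
  ... | no none = noCycle (4 + d) (s≤s (s≤s (s≤s (s≤s z≤n))))
        (closed-path G Q off a z λ { (suc i) _ l e → none (i , s≤s⁻¹ l , e) })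
  ... | yes (suc t , l , e) =
        closed-path-absurd b t (<-≤-trans (s≤s⁻¹ l) (s≤s⁻¹ lt)) (takePath G 1+t<2+d Q)
          (λ i h → off i (≤-trans h 1+t<2+d)) a e
    where
    1+t<2+d : 2 + t ≤ 2 + d
    1+t<2+d = s≤s (<⇒≤ l)
  closed-path-absurd (suc b) zero lt Q off a z | yes (zero , l , e) =
    distinct Q {0} {2} (s≤s z≤n) ≤-refl
      (diamondFree e a (symm G (edge Q (s≤s z≤n))) z (edge Q (s≤s (s≤s z≤n))))
  closed-path-absurd (suc b) (suc d) lt Q off a z | yes (zero , l , e) =
    closed-path-absurd b d (s≤s⁻¹ lt) (dropPath G 1 Q) (λ i h → off (suc i) (s≤s h)) e z

  -- Otherwise the piece of the path from `p i` to `p j` has length at least 2 and is closed by `v`.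
  neighbours-consecutive : ∀ {k p v i j} → InducedPath G k p → OffPath G k p v → i < j → j ≤ k →
                           Adj G v (p i) → Adj G v (p j) → j ≡ suc i
  neighbours-consecutive {k} {p} {v} {i} P off l h a b with m≤n⇒∃[o]m+o≡n l
  ... | zero  , refl = cong suc (+-identityʳ i)
  ... | suc d , refl = ⊥-elim (closed-path-absurd (suc d) d ≤-refl (dropPath G i (takePath G h′ P))
          (λ t ht → off (i + t) (≤-trans (+-monoʳ-≤ i ht) h′))
          (subst (Adj G v ∘ p) (sym (+-identityʳ i)) a) (subst (Adj G v ∘ p) (sym assoc) b))
    where
    assoc : i + (2 + d) ≡ suc i + suc d
    assoc = +-suc i (suc d)
    h′ : i + (2 + d) ≤ k
    h′ = subst (_≤ k) (sym assoc) h

  record Attachment (k : ℕ) (p : ℕ → Fin n) (v : Fin n) : Set where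
    field
      lo hi : ℕ
      hi≤k  : hi ≤ k
      width : hi ≡ lo ⊎ hi ≡ suc lo
      at-lo : Adj G v (p lo)
      at-hi : Adj G v (p hi)
      above : ∀ j → j ≤ k → Adj G v (p j) → lo ≤ j
      below : ∀ j → j ≤ k → Adj G v (p j) → j ≤ hi

    lo≤hi : lo ≤ hi
    lo≤hi = above hi hi≤k at-hi

    lo≤k : lo ≤ k
    lo≤k = ≤-trans lo≤hi hi≤k

  -- Any two neighbours on the path are consecutive, so besides the given one only its successor and
  -- then its predecessor have to be tested.
  attachment : ∀ {k p v} → InducedPath G k p → OffPath G k p v → ∀ i → i ≤ k → Adj G v (p i) → Attachment k p v
  attachment {k} {p} {v} P off i i≤k a = search (suc i ≤? k ×-dec adj? G v (p (suc i))) i i≤k a refl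
    where
    pair : ∀ i → suc i ≤ k → Adj G v (p i) → Adj G v (p (suc i)) → Attachment k p v
    pair i h a b = record
      { lo = i ; hi = suc i ; hi≤k = h ; width = inj₂ refl ; at-lo = a ; at-hi = b
      ; above = λ j hj e → ≮⇒≥ λ l →
          <-irrefl (sym (suc-injective (neighbours-consecutive P off (m≤n⇒m≤1+n l) h e b))) l
      ; below = λ j hj e → ≮⇒≥ λ l →
          <-irrefl (sym (neighbours-consecutive P off (<⇒≤ l) hj a e)) l }
    single : ∀ i → i ≤ k → Adj G v (p i) → (∀ j → suc j ≡ i → ¬ Adj G v (p j)) →
             ¬ (suc i ≤ k × Adj G v (p (suc i))) → Attachment k p v
    single i h a before after = record
      { lo = i ; hi = i ; hi≤k = h ; width = inj₁ refl ; at-lo = a ; at-hi = a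
      ; above = λ j hj e → ≮⇒≥ λ l → before j (sym (neighbours-consecutive P off l h e a)) e
      ; below = λ j hj e → ≮⇒≥ λ l → let q = neighbours-consecutive P off l hj a e in
          after (subst (_≤ k) q hj , subst (Adj G v ∘ p) q e) }
    search : Dec (suc i ≤ k × Adj G v (p (suc i))) → ∀ i′ → i′ ≤ k → Adj G v (p i′) → i ≡ i′ → Attachment k p v
    search (yes (h , b)) _ _ _ refl = pair i h a b
    search (no after) zero h a refl = single zero h a (λ _ ()) after
    search (no after) (suc i′) h a refl with adj? G v (p i′)
    ... | yes b = pair i′ h b a
    ... | no ¬b = single (suc i′) h a (λ { _ refl → ¬b }) after

  reverse-attachment : ∀ {k p v} → Attachment k p v → Attachment k (p ∘ (k ∸_)) v
  reverse-attachment {k} {p} {v} A = record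
    { lo = k ∸ hi ; hi = k ∸ lo ; hi≤k = m∸n≤m k lo ; width = width′ width
    ; at-lo = subst (Adj G v ∘ p) (sym (m∸[m∸n]≡n hi≤k)) at-hi
    ; at-hi = subst (Adj G v ∘ p) (sym (m∸[m∸n]≡n lo≤k)) at-lo
    ; above = λ j h a → subst (k ∸ hi ≤_) (m∸[m∸n]≡n h) (∸-monoʳ-≤ k (below (k ∸ j) (m∸n≤m k j) a))
    ; below = λ j h a → subst (_≤ k ∸ lo) (m∸[m∸n]≡n h) (∸-monoʳ-≤ k (above (k ∸ j) (m∸n≤m k j) a)) }
    where
    open Attachment A
    width′ : hi ≡ lo ⊎ hi ≡ suc lo → k ∸ lo ≡ k ∸ hi ⊎ k ∸ lo ≡ suc (k ∸ hi)
    width′ (inj₁ e) = inj₁ (cong (k ∸_) (sym e))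
    width′ (inj₂ e) = inj₂ (trans (+-∸-assoc 1 (subst (_≤ k) e hi≤k)) (cong (λ t → suc (k ∸ t)) (sym e)))

  module _ {k p v} (P : InducedPath G k p) (ov : OffPath G k p v) (A : Attachment k p v) where
    open Attachment A

    private
      shift-≤ : ∀ {i m} → hi + m ≡ k → i ≤ m → hi + i ≤ k
      shift-≤ e h = subst (_ ≤_) e (+-monoʳ-≤ hi h)

    -- The path `v`, `p hi`, ..., `p k` is induced because `hi` is the last neighbour of `v`.
    hook : ∀ {m} → hi + m ≡ k → InducedPath G (suc m) (cons G v (p ∘ (hi +_)))
    hook {m} e = consPath G (dropPath G hi (subst (λ t → InducedPath G t p) (sym e) P))
      (λ i h → ov (hi + i) (shift-≤ e h))
      (subst (Adj G v ∘ p) (sym (+-identityʳ hi)) at-hi)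
      (λ i h a → m+1+n≰m hi (below (hi + suc i) (shift-≤ e h) a))

    -- The path `x`, `v`, `p hi`, ..., `p k` gains two vertices and loses at most `p 0`; it is cut
    -- to length `suc k`.
    extend : ∀ {x} → (∀ i → i ≤ k → Clear G (p i) x) → Adj G v x → hi ≤ 1 →
             ∃[ q ] InducedPath G (suc k) q
    extend {x} clear vx hi≤1 with m≤n⇒∃[o]m+o≡n hi≤k
    ... | m , e = _ , takePath G (s≤s (subst (_≤ suc m) e (+-monoˡ-≤ m hi≤1)))
      (consPath G (hook e) (off-cons G (adj⇒≢ G vx) λ i h → proj₁ (clear _ (shift-≤ e h)))
        (symm G vx) λ i h a → proj₂ (clear (hi + i) (shift-≤ e (s≤s⁻¹ h))) (symm G a))

    -- On the hook of `v`, the vertex `w` is adjacent to `v` at index 0 and to `p j` at index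
    -- `j - hi + 1`. These indices must be consecutive.
    common-neighbour-above : ∀ {w} → OffPath G k p w → Adj G v w → ∀ j → j ≤ k → Adj G w (p j) → hi ≤ j → j ≡ hi
    common-neighbour-above {w} offw vw j j≤k a hi≤j with m≤n⇒∃[o]m+o≡n hi≤k | m≤n⇒∃[o]m+o≡n hi≤j
    ... | m , e | j′ , refl = trans (cong (hi +_) (suc-injective
      (neighbours-consecutive (hook e) (off-cons G (adj⇒≢ G vw) λ i h → offw (hi + i) (shift-≤ e h))
        (s≤s z≤n) (s≤s (+-cancelˡ-≤ hi j′ m (subst (hi + j′ ≤_) (sym e) j≤k))) (symm G vw) a)))
      (+-identityʳ hi)

  common-neighbour : ∀ {k p v w} → InducedPath G k p → OffPath G k p v → OffPath G k p w → Adj G v w →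
                     Attachment k p v → Attachment k p w → ∃[ j ] (j ≤ k × Adj G v (p j) × Adj G w (p j))
  common-neighbour {k} {p} {v} {w} P offv offw vw A B = cases (A.hi ≤? B.lo)
    where
    module A = Attachment A
    module B = Attachment B
    lo≤lo : B.lo < A.hi → B.lo ≤ A.lo
    lo≤lo l with A.width
    ... | inj₁ e = subst (B.lo ≤_) e (<⇒≤ l)
    ... | inj₂ e = s≤s⁻¹ (subst (B.lo <_) e l)
    cases : Dec (A.hi ≤ B.lo) → ∃[ j ] (j ≤ k × Adj G v (p j) × Adj G w (p j))
    cases (yes l) = B.lo , B.lo≤k ,
      subst (Adj G v ∘ p) (sym (common-neighbour-above P offv A offw vw B.lo B.lo≤k B.at-lo l)) A.at-hi , B.at-lo
    -- Since `A.hi` is at most `A.lo + 1`, now `B.lo ≤ A.lo`, and the previous argument applies on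
    -- the reversed path.
    cases (no g) = B.lo , B.lo≤k , subst (Adj G v ∘ p) (sym lo≡lo) A.at-lo , B.at-lo
      where
      lo≡lo : B.lo ≡ A.lo
      lo≡lo = ∸-cancelˡ-≡ B.lo≤k A.lo≤k
        (common-neighbour-above (reversePath G P) (off-reverse G {p = p} offv) (reverse-attachment A)
          (off-reverse G {p = p} offw) vw (k ∸ B.lo) (m∸n≤m k B.lo)
          (Attachment.at-hi (reverse-attachment B)) (∸-monoʳ-≤ k (lo≤lo (≰⇒> g))))

  -- The bound is written `i < suc k` to suit the bounded search `anyUpTo?`.
  OnPath Dominated : ℕ → (ℕ → Fin n) → Fin n → Set
  OnPath    k p v = ∃[ i ] (i < suc k × p i ≡ v)
  Dominated k p v = ∃[ i ] (i < suc k × (p i ≡ v ⊎ Adj G v (p i)))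

  onPath? : ∀ k p v → Dec (OnPath k p v)
  onPath? k p v = anyUpTo? (λ i → p i Finₚ.≟ v) (suc k)

  dominated? : ∀ k p v → Dec (Dominated k p v)
  dominated? k p v = anyUpTo? (λ i → (p i Finₚ.≟ v) ⊎-dec adj? G v (p i)) (suc k)

  off : ∀ {k p v} → ¬ OnPath k p v → OffPath G k p v
  off ¬on i h e = ¬on (i , s≤s h , e)

  dominated⇒attachment : ∀ {k p v} → InducedPath G k p → Dominated k p v → OffPath G k p v → Attachment k p v
  dominated⇒attachment P (i , h , inj₁ e) o = ⊥-elim (o i (s≤s⁻¹ h) e)
  dominated⇒attachment P (i , h , inj₂ a) o = attachment P o i (s≤s⁻¹ h) a

  -- Growing an induced path until it dominates the graph

  module Growth
    (noM₂ : ¬ (M₂ IsInducedSubgraphOf G)) (noM₃ : ¬ (M₃ IsInducedSubgraphOf G)) where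

    grow : ∀ {k p v x} → InducedPath G k p → OffPath G k p v → Attachment k p v →
           (∀ i → i ≤ k → Clear G (p i) x) → Adj G v x → ∃[ q ] InducedPath G (suc k) q
    grow {k} {p} {v} {x} P off A clear vx with Attachment.hi A ≤? 1 | k ∸ Attachment.lo A ≤? 1
    ... | yes l | _     = extend P off A clear vx l
    -- The far end of the path: after reversal the upper attachment index is `k ∸ lo`.
    ... | no _  | yes l = extend (reversePath G P) (off-reverse G {p = p} off) (reverse-attachment A)
                            (λ i _ → clear (k ∸ i) (m∸n≤m k i)) vx l
    ... | no l  | no l′ = ⊥-elim (inner (≰⇒> l) (subst (_≤ k) (+-comm 2 lo)
                            (m≤o∸n⇒m+n≤o 2 (Attachment.lo≤k A) (≰⇒> l′))) width)
      where
      open Attachment A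
      inner : 2 ≤ hi → lo + 2 ≤ k → ¬ (hi ≡ lo ⊎ hi ≡ suc lo)
      inner 2≤hi lo+2≤k (inj₁ e) with m≤n⇒∃[o]m+o≡n (subst (2 ≤_) e 2≤hi)
      -- Here `s` is `lo - 2`: the single neighbour `p lo` has two path vertices on either side.
      ... | s , e′ = noM₂ (path⇒M₂ G (dropPath G s (takePath G s+4≤k P))
              (λ i h → off (s + i) (bound h)) (λ i h → clear (s + i) (bound h)) vx
              (subst (Adj G v ∘ p) (sym s+2≡lo) at-lo)
              λ i h i≢2 a → i≢2 (+-cancelˡ-≡ s i 2 (trans (≤-antisym
                (subst (s + i ≤_) e (below (s + i) (bound h) a)) (above (s + i) (bound h) a)) (sym s+2≡lo))))
        where
        s+2≡lo : s + 2 ≡ lo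
        s+2≡lo = trans (+-comm s 2) e′
        s+4≤k : s + 4 ≤ k
        s+4≤k = subst (_≤ k) (trans (cong (_+ 2) (sym s+2≡lo)) (+-assoc s 2 2)) lo+2≤k
        bound : ∀ {i} → i ≤ 4 → s + i ≤ k
        bound h = ≤-trans (+-monoʳ-≤ s h) s+4≤k
      inner 2≤hi lo+2≤k (inj₂ e) with m≤n⇒∃[o]m+o≡n (s≤s⁻¹ (subst (2 ≤_) e 2≤hi))
      -- Here `s` is `lo - 1`: the two neighbours of `v` have one path vertex on either side.
      ... | s , e′ = noM₃ (path⇒M₃ G (dropPath G s (takePath G s+3≤k P))
              (λ i h → off (s + i) (bound h)) (λ i h → clear (s + i) (bound h)) vx
              (subst (Adj G v ∘ p) (sym s+1≡lo) at-lo)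
              (subst (Adj G v ∘ p) (sym s+2≡hi) at-hi)
              (λ a → <⇒≱ (subst (s + 0 <_) s+1≡lo (+-monoʳ-< s (s≤s z≤n))) (above (s + 0) (bound z≤n) a))
              (λ a → <⇒≱ (subst (_< s + 3) s+2≡hi (+-monoʳ-< s ≤-refl)) (below (s + 3) s+3≤k a)))
        where
        s+1≡lo : s + 1 ≡ lo
        s+1≡lo = trans (+-comm s 1) e′
        s+2≡hi : s + 2 ≡ hi
        s+2≡hi = trans (+-suc s 1) (trans (cong suc s+1≡lo) (sym e))
        s+3≤k : s + 3 ≤ k
        s+3≤k = subst (_≤ k) (trans (cong (_+ 2) (sym s+1≡lo)) (+-assoc s 1 2)) lo+2≤k
        bound : ∀ {i} → i ≤ 3 → s + i ≤ k
        bound h = ≤-trans (+-monoʳ-≤ s h) s+3≤k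

    first-exit : ∀ {P : Fin n → Set} → (∀ v → Dec (P v)) → ∀ {x y} → Star (Adj G) x y → P x → ¬ P y →
                 ∃[ u ] ∃[ w ] (Adj G u w × P u × ¬ P w)
    first-exit P? ε px ¬py = ⊥-elim (¬py px)
    first-exit P? (_◅_ {j = z} a s) px ¬py with P? z
    ... | yes pz = first-exit P? s pz ¬py
    ... | no ¬pz = _ , z , a , px , ¬pz

    -- A walk from `p 0` to `v` leaves the dominated set along some edge `u w`. The vertex `u` is
    -- not on the path, since `w` would then be dominated, so `u` is attached to it and `w` is clear
    -- of it.
    undominated⇒longer : ∀ {k p v} → (∀ x y → Star (Adj G) x y) → InducedPath G k p → ¬ Dominated k p v →
                         ∃[ q ] InducedPath G (suc k) q
    undominated⇒longer {k} {p} {v} conn P ¬dom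
      with first-exit (dominated? k p) (conn (p 0) v) (0 , s≤s z≤n , inj₁ refl) ¬dom
    ... | u , w , uw , dom-u , ¬dw with onPath? k p u
    ...   | yes (j , hj , refl) = ⊥-elim (¬dw (j , hj , inj₂ (symm G uw)))
    ...   | no ¬on = grow P (off ¬on) (dominated⇒attachment P dom-u (off ¬on))
              (λ j hj → (λ e → ¬dw (j , s≤s hj , inj₁ e)) , (λ a → ¬dw (j , s≤s hj , inj₂ (symm G a)))) uw

    -- Every round lengthens the path by one edge. As `path-bound` gives `k < n`, the invariant
    -- `n ≤ k + fuel` keeps the fuel from running out.
    dominating-path : (∀ x y → Star (Adj G) x y) → ∀ fuel {k p} → n ≤ k + fuel → InducedPath G k p →
                      ∃[ k′ ] ∃[ q ] (InducedPath G k′ q × (∀ v → Dominated k′ q v))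
    dominating-path conn zero {k} le P =
      ⊥-elim (<-irrefl refl (<-≤-trans (path-bound G P) (subst (n ≤_) (+-identityʳ k) le)))
    dominating-path conn (suc fuel) {k} {p} le P with all? (dominated? k p)
    ... | yes dom = k , p , P , dom
    ... | no ¬dom = let (v , ¬dv) = Finₚ.¬∀⟶∃¬ n _ (dominated? k p) ¬dom
                        (q , Q)   = undominated⇒longer conn P ¬dv
                    in dominating-path conn fuel (subst (n ≤_) (+-suc k fuel) le) Q

least : ∀ {n} {P : Fin n → Set} → (∀ i → Dec (P i)) → ∃[ i ] P i → ∃[ i ] (P i × (∀ j → P j → toℕ i ≤ toℕ j))
least {suc n} P? (i , pi) with P? zero
... | yes p₀ = zero , p₀ , λ _ _ → z≤n
least {suc n} P? (zero  , pi) | no ¬p₀ = ⊥-elim (¬p₀ pi)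
least {suc n} P? (suc i , pi) | no ¬p₀ =
  let (j , pj , min) = least (P? ∘ suc) (i , pi)
  in suc j , pj , λ { zero p₀ → ⊥-elim (¬p₀ p₀) ; (suc l) pl → s≤s (min l pl) }

-- Closed integer intervals as straight grid paths

module IntervalRepresentation {n} {G : Graph n} (N : ℕ) (first last : Fin n → ℕ)
  (first≤last : ∀ v → first v ≤ last v) (last≤N : ∀ v → last v ≤ N)
  (adj⇔meet : ∀ u v → u ≢ v → Adj G u v ⇔ (first u ≤ last v × first v ≤ last u)) where

  module _ (v : Fin n) where

    -- The path runs from column `first v` to column `last v + 1`: each integer `t` stands for the
    -- unit edge from `t` to `t + 1`, so even a one-point interval yields a nontrivial path.
    length : ℕ
    length = suc (last v) ∸ first v

    first+length : first v + length ≡ suc (last v)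
    first+length = m+[n∸m]≡n (m≤n⇒m≤1+n (first≤last v))

    position : Fin (suc length) → Fin (2 + N)
    position i = fromℕ< {first v + toℕ i} (s≤s (≤-trans (+-monoʳ-≤ (first v) (s≤s⁻¹ (toℕ<n i)))
      (subst (_≤ suc N) (sym first+length) (s≤s (last≤N v)))))

    toℕ-position : ∀ i → toℕ (position i) ≡ first v + toℕ i
    toℕ-position i = toℕ-fromℕ< _

    toℕ-source : ∀ i → toℕ (position (inject₁ i)) ≡ first v + toℕ i
    toℕ-source i = trans (toℕ-position (inject₁ i)) (cong (first v +_) (Finₚ.toℕ-inject₁ i))

    toℕ-target : ∀ i → toℕ (position (suc i)) ≡ suc (first v + toℕ i)
    toℕ-target i = trans (toℕ-position (suc i)) (+-suc (first v) (toℕ i))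

    path : GridPath 1 (2 + N)
    path = record
      { len = length
      ; 1≤len = m<n⇒0<n∸m (s≤s (first≤last v))
      ; point = λ i → zero , position i
      ; distinct = λ {i} {j} e → toℕ-injective (+-cancelˡ-≡ (first v) _ _
          (trans (sym (toℕ-position i)) (trans (cong (toℕ ∘ proj₂) e) (toℕ-position j))))
      ; step = λ i → inj₁ (refl , inj₁ (trans (cong suc (toℕ-source i)) (sym (toℕ-target i)))) }

    unit : ∀ i → IsUnit (true , 0) (first v + toℕ i) (source path i) (target path i)
    unit i = inj₁ (cong (0 ,_) (toℕ-source i) , cong (0 ,_) (toℕ-target i))

    path-segment : Segment path
    path-segment = record
      { line = true , 0 ; lo = first v ; hi = suc (last v) ; lo<hi = s≤s (first≤last v)
      ; within = λ i → first v + toℕ i , m≤m+n (first v) (toℕ i) ,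
          subst (first v + toℕ i <_) first+length (+-monoʳ-< (first v) (toℕ<n i)) , unit i
      ; onto = λ t l h → let i = fromℕ< (∸-monoˡ-< h l) in
          i , subst (λ s → IsUnit (true , 0) s (source path i) (target path i))
                    (trans (cong (first v +_) (toℕ-fromℕ< _)) (m+[n∸m]≡n l)) (unit i) }

    path-straight : ¬ HasBend path
    path-straight (_ , _ , _ , inj₁ (_ , inj₁ () , _))
    path-straight (_ , _ , _ , inj₁ (_ , inj₂ () , _))
    path-straight (_ , _ , _ , inj₂ ((inj₁ () , _) , _))
    path-straight (_ , _ , _ , inj₂ ((inj₂ () , _) , _))

  intervals⇒B₀ : B₀ G
  intervals⇒B₀ = record
    { rows = 1 ; cols = 2 + N ; path = path
    ; adj⇔share = λ u v u≢v →
        let e = adj⇔meet u v u≢v ; e′ = share⇔overlap (path-segment u) (path-segment v) in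
        mk⇔ (λ a → let (x , y) = to e a in from e′ (refl , s≤s x , s≤s y))
            (λ s → let (_ , x , y) = to e′ s in from e (s≤s⁻¹ x , s≤s⁻¹ y)) }
    , path-straight

-- The vertex p i becomes [ i S , (i + 1) S ] with S = n + 1.  A vertex adjacent
-- to both p i and p (i + 1) becomes the point (i + 1) S; one adjacent to p i
-- only becomes a point strictly between i S and (i + 1) S, the same for two
-- adjacent vertices.
module Caterpillar {n} (G : Graph n)
  (noCycle : ∀ r → 4 ≤ r → ¬ (C r IsInducedSubgraphOf G)) (diamondFree : DiamondFree G) where

  open InducedPath
  open Chordal G noCycle diamondFree

  module _ {k p} (P : InducedPath G k p) (dom : ∀ v → Dominated k p v) where

    private
      Off : Fin n → Set
      Off = OffPath G k p

      S : ℕ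
      S = suc n

      attach : ∀ {v} → Off v → Attachment k p v
      attach {v} = dominated⇒attachment P (dom v)

    -- A second neighbour `p i` of `v` is next to `p j`, so the edge from `v` to `p j` lies in
    -- triangles with `w` and with `p i`; but `w` is off the path.
    only-common-neighbour : ∀ {v w j} → Off v → Off w → Adj G v w → j ≤ k → Adj G v (p j) → Adj G w (p j) →
                            ∀ i → i ≤ k → Adj G v (p i) → i ≡ j
    only-common-neighbour {v} {w} {j} ov ow vw j≤k vj wj i i≤k vi with i ≟ j
    ... | yes e  = e
    ... | no i≢j = ⊥-elim (ow i i≤k (sym (diamondFree vj vw (symm G wj) vi (from (pathAdj G P j≤k i≤k) next))))
      where
      next : suc j ≡ i ⊎ suc i ≡ j
      next with <-cmp i j
      ... | tri< l _ _ = inj₂ (sym (neighbours-consecutive P ov l j≤k vi vj))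
      ... | tri≈ _ e _ = ⊥-elim (i≢j e)
      ... | tri> _ _ l = inj₁ (sym (neighbours-consecutive P ov l i≤k vj vi))

    -- Both `v` and `w` form a triangle with `u` and its only path neighbour. Adjacency among
    -- outside vertices is thus a matching.
    partner-unique : ∀ {u v w} → Off u → Off v → Off w → Adj G u v → Adj G u w → v ≡ w
    partner-unique ou ov ow uv uw =
      let (j , j≤k , uj , vj) = common-neighbour P ou ov uv (attach ou) (attach ov)
          (i , i≤k , ui , wi) = common-neighbour P ou ow uw (attach ou) (attach ow)
          i≡j = only-common-neighbour ou ov uv j≤k uj vj i i≤k ui
      in diamondFree uj uv (symm G vj) uw (symm G (subst (Adj G _ ∘ p) i≡j wi))

    Mate : Rel (Fin n) 0ℓ
    Mate v w = v ≡ w ⊎ (Adj G v w × Off w)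

    mate? : Decidable Mate
    mate? v w = (v Finₚ.≟ w) ⊎-dec (adj? G v w ×-dec
      map′ off (λ o (i , h , e) → o i (s≤s⁻¹ h) e) (¬? (onPath? k p w)))

    leader : ∀ v → ∃[ w ] (Mate v w × (∀ x → Mate v x → toℕ w ≤ toℕ x))
    leader v = least (mate? v) (v , inj₁ refl)

    -- A label equal for two matched outside vertices and different for any other two: the least
    -- member of the pair, or the vertex itself if unmatched.
    rank : Fin n → ℕ
    rank v = toℕ (proj₁ (leader v))

    rank-≤ : ∀ {v w} → Off v → Off w → Adj G v w → rank v ≤ rank w
    rank-≤ {v} {w} ov ow vw = proj₂ (proj₂ (leader v)) (proj₁ (leader w)) (transfer (proj₁ (proj₂ (leader w))))
      where
      transfer : ∀ {x} → Mate w x → Mate v x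
      transfer (inj₁ refl)      = inj₂ (vw , ow)
      transfer (inj₂ (wx , ox)) = inj₁ (partner-unique ow ov ox (symm G vw) wx)

    -- Equal ranks mean a common leader, and a leader other than `v` and `w` would have both as
    -- partners.
    rank-injective : ∀ {v w} → Off v → Off w → v ≢ w → rank v ≡ rank w → Adj G v w
    rank-injective {v} {w} ov ow v≢w e =
      meet (proj₁ (proj₂ (leader v))) (subst (Mate w) (sym (toℕ-injective e)) (proj₁ (proj₂ (leader w))))
      where
      meet : ∀ {x} → Mate v x → Mate w x → Adj G v w
      meet (inj₁ refl)      (inj₁ refl)      = ⊥-elim (v≢w refl)
      meet (inj₁ refl)      (inj₂ (wv , _))  = symm G wv
      meet (inj₂ (vw , _))  (inj₁ refl)      = vw
      meet (inj₂ (vx , ox)) (inj₂ (wx , _))  = ⊥-elim (v≢w (partner-unique ox ov ow (symm G vx) (symm G wx)))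

    block-≤ : ∀ {a i j} → a < S → j * S ≤ a + i * S → j ≤ i
    block-≤ {a} {i} {j} a<S h = s≤s⁻¹ (*-cancelʳ-< S j (suc i) (≤-<-trans h (+-monoˡ-< (i * S) a<S)))

    block-≥ : ∀ {a i j} → suc a + i * S ≤ suc j * S → i ≤ j
    block-≥ {a} {i} {j} h = s≤s⁻¹ (*-cancelʳ-< S i (suc j) (≤-trans (s≤s (m≤n+m (i * S) a)) h))

    -- This keeps the offset `suc (rank v)` strictly inside a block, which is why the block width is
    -- `n + 1`.
    rank<S : ∀ v → suc (rank v) < S
    rank<S v = s≤s (toℕ<n (proj₁ (leader v)))

    -- The width is a separate argument so that proofs can split on it without unfolding `attach`.
    point : Fin n → (lo : ℕ) {hi : ℕ} → hi ≡ lo ⊎ hi ≡ suc lo → ℕ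
    point v lo (inj₁ _) = suc (rank v) + lo * S
    point v lo (inj₂ _) = suc lo * S

    slot : ∀ {v} → Off v → ℕ
    slot {v} o = point v (Attachment.lo (attach o)) (Attachment.width (attach o))

    point≤ : ∀ v lo {hi} (wd : hi ≡ lo ⊎ hi ≡ suc lo) → hi ≤ k → point v lo wd ≤ suc k * S
    point≤ v lo (inj₁ refl) h = ≤-trans (+-monoˡ-≤ (lo * S) (<⇒≤ (rank<S v))) (*-monoˡ-≤ S (s≤s h))
    point≤ v lo (inj₂ refl) h = *-monoˡ-≤ S (m≤n⇒m≤1+n h)

    slot-path : ∀ {v} (o : Off v) j → j ≤ k → Adj G v (p j) ⇔ (j * S ≤ slot o × slot o ≤ suc j * S)
    slot-path {v} o j j≤k = mk⇔ (λ a → forth width (above j j≤k a) (below j j≤k a)) (λ (x , y) → back width x y)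
      where
      open Attachment (attach o)
      forth : ∀ (wd : hi ≡ lo ⊎ hi ≡ suc lo) → lo ≤ j → j ≤ hi → j * S ≤ point v lo wd × point v lo wd ≤ suc j * S
      forth (inj₁ e) l h with ≤-antisym l (subst (j ≤_) e h)
      ... | refl = m≤n+m (j * S) (suc (rank v)) , +-monoˡ-≤ (j * S) (<⇒≤ (rank<S v))
      forth (inj₂ e) l h = *-monoˡ-≤ S (subst (j ≤_) e h) , *-monoˡ-≤ S (s≤s l)
      back : ∀ (wd : hi ≡ lo ⊎ hi ≡ suc lo) → j * S ≤ point v lo wd → point v lo wd ≤ suc j * S → Adj G v (p j)
      back (inj₁ _) x y = subst (Adj G v ∘ p) (≤-antisym (block-≥ y) (block-≤ (rank<S v) x)) at-lo
      back (inj₂ e) x y with m≤n⇒m<n∨m≡n (s≤s⁻¹ (*-cancelʳ-≤ (suc lo) (suc j) S y))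
      ... | inj₂ lo≡j = subst (Adj G v ∘ p) lo≡j at-lo
      ... | inj₁ lo<j = subst (Adj G v ∘ p) (trans e (≤-antisym lo<j (*-cancelʳ-≤ j (suc lo) S x))) at-hi

    slot-off : ∀ {v w} (ov : Off v) (ow : Off w) → v ≢ w → Adj G v w ⇔ slot ov ≡ slot ow
    slot-off {v} {w} ov ow v≢w = mk⇔ (forth A.width B.width) (back A.width B.width)
      where
      module A = Attachment (attach ov)
      module B = Attachment (attach ow)
      forth : ∀ a b → Adj G v w → point v A.lo a ≡ point w B.lo b
      forth a b vw = same a b
        where
        common = common-neighbour P ov ow vw (attach ov) (attach ow)
        j    = proj₁ common
        j≤k  = proj₁ (proj₂ common)
        vj   = proj₁ (proj₂ (proj₂ common))
        wj   = proj₂ (proj₂ (proj₂ common))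
        onlyA = only-common-neighbour ov ow vw j≤k vj wj
        onlyB = only-common-neighbour ow ov (symm G vw) j≤k wj vj
        same : ∀ a b → point v A.lo a ≡ point w B.lo b
        same (inj₁ _) (inj₁ _) = cong₂ (λ r i → suc r + i * S)
          (≤-antisym (rank-≤ ov ow vw) (rank-≤ ow ov (symm G vw)))
          (trans (onlyA A.lo A.lo≤k A.at-lo) (sym (onlyB B.lo B.lo≤k B.at-lo)))
        -- A vertex with an outside neighbour has only one neighbour on the path, so width two
        -- cannot occur.
        same (inj₂ e) _ = ⊥-elim (1+n≢n (trans (sym e)
          (trans (onlyA A.hi A.hi≤k A.at-hi) (sym (onlyA A.lo A.lo≤k A.at-lo)))))
        same (inj₁ _) (inj₂ e) = ⊥-elim (1+n≢n (trans (sym e)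
          (trans (onlyB B.hi B.hi≤k B.at-hi) (sym (onlyB B.lo B.lo≤k B.at-lo)))))
      strictly-between : ∀ u i j → suc (rank u) + i * S ≢ suc j * S
      strictly-between u i j e = <-irrefl refl
        (≤-trans (block-≤ {i = i} {suc j} (rank<S u) (≤-reflexive (sym e))) (block-≥ {rank u} {i} {j} (≤-reflexive e)))
      back : ∀ a b → point v A.lo a ≡ point w B.lo b → Adj G v w
      back (inj₁ _) (inj₁ _) e = rank-injective ov ow v≢w (suc-injective (+-cancelʳ-≡ (A.lo * S) _ _
        (trans e (cong (λ i → suc (rank w) + i * S) (sym lo≡lo)))))
        where
        lo≡lo : A.lo ≡ B.lo
        lo≡lo = ≤-antisym
          (block-≤ (rank<S w) (≤-trans (m≤n+m (A.lo * S) (suc (rank v))) (≤-reflexive e)))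
          (block-≤ (rank<S v) (≤-trans (m≤n+m (B.lo * S) (suc (rank w))) (≤-reflexive (sym e))))
      back (inj₁ _) (inj₂ _) e = ⊥-elim (strictly-between v A.lo B.lo e)
      back (inj₂ _) (inj₁ _) e = ⊥-elim (strictly-between w B.lo A.lo (sym e))
      -- At a common block boundary, `v` and `w` complete the same path edge to triangles and hence
      -- coincide.
      back (inj₂ a) (inj₂ b) e = ⊥-elim (v≢w (diamondFree
        (edge P (subst (_≤ k) a A.hi≤k)) (symm G A.at-lo) (symm G (subst (Adj G v ∘ p) a A.at-hi))
        (symm G (subst (Adj G w ∘ p) (sym lo≡lo) B.at-lo))
        (symm G (subst (Adj G w ∘ p) (trans b (cong suc (sym lo≡lo))) B.at-hi))))
        where
        lo≡lo : A.lo ≡ B.lo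
        lo≡lo = suc-injective (*-cancelʳ-≡ (suc A.lo) (suc B.lo) S e)

    place : ∀ v → OnPath k p v ⊎ Off v
    place v with onPath? k p v
    ... | yes on = inj₁ on
    ... | no ¬on = inj₂ (off ¬on)

    first last : ∀ {v} → OnPath k p v ⊎ Off v → ℕ
    first (inj₁ (i , _)) = i * S
    first (inj₂ o)       = slot o
    last  (inj₁ (i , _)) = suc i * S
    last  (inj₂ o)       = slot o

    first≤last : ∀ {v} (π : OnPath k p v ⊎ Off v) → first π ≤ last π
    first≤last (inj₁ (i , _)) = m≤n+m (i * S) S
    first≤last (inj₂ _)       = ≤-refl

    last≤ : ∀ {v} (π : OnPath k p v ⊎ Off v) → last π ≤ suc k * S
    last≤ (inj₁ (i , h , _)) = *-monoˡ-≤ S h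
    last≤ {v} (inj₂ o)       = point≤ v lo width hi≤k
      where
      open Attachment (attach o)

    adj⇔meet : ∀ {u v} (π : OnPath k p u ⊎ Off u) (ρ : OnPath k p v ⊎ Off v) → u ≢ v →
               Adj G u v ⇔ (first π ≤ last ρ × first ρ ≤ last π)
    adj⇔meet (inj₁ (i , s≤s hi , refl)) (inj₁ (j , s≤s hj , refl)) u≢v = mk⇔ (forth ∘ to link) (from link ∘ back)
      where
      link = pathAdj G P hi hj
      forth : suc i ≡ j ⊎ suc j ≡ i → i * S ≤ suc j * S × j * S ≤ suc i * S
      forth (inj₁ refl) = *-monoˡ-≤ S (m≤n+m i 2) , ≤-refl
      forth (inj₂ refl) = ≤-refl , *-monoˡ-≤ S (m≤n+m j 2)
      back : i * S ≤ suc j * S × j * S ≤ suc i * S → suc i ≡ j ⊎ suc j ≡ i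
      back (x , y) with <-cmp i j
      ... | tri< l _ _ = inj₁ (≤-antisym l (*-cancelʳ-≤ j (suc i) S y))
      ... | tri≈ _ e _ = ⊥-elim (u≢v (cong p e))
      ... | tri> _ _ l = inj₂ (≤-antisym l (*-cancelʳ-≤ i (suc j) S x))
    adj⇔meet (inj₁ (i , s≤s hi , refl)) (inj₂ o) _ =
      let e = slot-path o i hi in mk⇔ (to e ∘ symm G) (symm G ∘ from e)
    adj⇔meet (inj₂ o) (inj₁ (i , s≤s hi , refl)) _ =
      let e = slot-path o i hi in mk⇔ (λ a → proj₂ (to e a) , proj₁ (to e a)) (λ (x , y) → from e (y , x))
    adj⇔meet (inj₂ o) (inj₂ o′) u≢v =
      let e = slot-off o o′ u≢v in
      mk⇔ (λ a → ≤-reflexive (to e a) , ≤-reflexive (sym (to e a))) (λ (x , y) → from e (≤-antisym x y))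

    dominating-path⇒B₀ : B₀ G
    dominating-path⇒B₀ = IntervalRepresentation.intervals⇒B₀ (suc k * S) (first ∘ place) (last ∘ place)
      (first≤last ∘ place) (last≤ ∘ place) (λ u v → adj⇔meet (place u) (place v))

-- Both directions of the characterisation for cacti

theorem5p7 : ∀ {n : ℕ} (G : Graph n) → Cactus G →
    B₀ G ⇔
    (¬ (M₂ IsInducedSubgraphOf G) ×
    ¬ (M₃ IsInducedSubgraphOf G) ×
    (∀ (r : ℕ) → 4 ≤ r → ¬ (C r IsInducedSubgraphOf G)))
theorem5p7 {n} G cactus@((root , conn) , _) = mk⇔ forth back
  where
  forth : B₀ G → ¬ (M₂ IsInducedSubgraphOf G) × ¬ (M₃ IsInducedSubgraphOf G) ×
          (∀ (r : ℕ) → 4 ≤ r → ¬ (C r IsInducedSubgraphOf G))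
  forth b = (λ s → asteroidal-not-interval M₂ M₂-asteroidal (restrict s M))
          , (λ s → asteroidal-not-interval M₃ M₃-asteroidal (restrict s M))
          , (λ r 4≤r s → cycle-not-interval 4≤r (restrict s M))
    where
    M : IntervalModel G
    M = B₀⇒model b
  back : ¬ (M₂ IsInducedSubgraphOf G) × ¬ (M₃ IsInducedSubgraphOf G) ×
         (∀ (r : ℕ) → 4 ≤ r → ¬ (C r IsInducedSubgraphOf G)) → B₀ G
  back (noM₂ , noM₃ , noCycle) =
    -- The growth starts from the one-vertex path at `root`; its length is 0, so `n` is enough fuel.
    let (_ , _ , P , dom) = dominating-path conn n ≤-refl trivial
    in Caterpillar.dominating-path⇒B₀ G noCycle diamondFree P dom
    where
    diamondFree : DiamondFree G
    diamondFree = cactus⇒diamondFree G cactus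
    open Chordal G noCycle diamondFree
    open Growth noM₂ noM₃
    trivial : InducedPath G 0 (λ _ → root)
    trivial = record { distinct = λ { () z≤n } ; edge = λ () ; chordless = λ { () z≤n } }
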